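{- Let $(\mathcal{S}^x,H)$ be a finite thick STGQ of order $(s,s)$ with $s$ odd, and suppose that for every affine line $L$ the stabilizer $H_L$ is elementary abelian. Then for every affine line $L$, $H_L$ contains at least $|Z(H)|$ elements which fix every line through the point $\mathrm{proj}_Lx$, i.e. at least $|Z(H)|$ root-elations with i-root $(x,\,x\,\mathrm{proj}_Lx,\,\mathrm{proj}_Lx)$.
   Context: A finite GQ of order $(s,t)$: every line has $s+1$ points, every point lies on $t+1$ lines, and for each point $p$ and line $L$ not through $p$ exactly one point of $L$ is collinear with $p$; thick means $s,t\ge2$. An EGQ $(\mathcal{S}^x,H)$: $H\le\mathrm{Aut}(\mathcal{S})$ fixes every line through $x$ and acts sharply transitively on the points not collinear with $x$. A symmetry with center $x$ fixes every point collinear with $x$; an STGQ is an EGQ of order $(s,t)$ whose elation group contains a group of $t$ symmetries with center $x$. Affine lines are lines not through $x$; for such $L$, $\mathrm{proj}_Lx$ is the unique point of $L$ collinear with $x$. -}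

module Defs where

open import Level using (0ℓ)
open import Data.Nat using (ℕ; zero; suc; _≤_)
open import Data.Nat.Primality using (Prime)
open import Data.Fin using (Fin; _≟_)
open import Data.Fin.Properties using (all?; any?)
open import Data.List using (length; filter; allFin)
open import Data.Product using (_×_; _,_; ∃; ∃-syntax; ∃!; Σ)
open import Relation.Unary using (Pred; Decidable)
open import Relation.Nullary using (¬_; Dec)
open import Relation.Nullary.Decidable using (_→-dec_; _×-dec_)
open import Relation.Binary.PropositionalEquality using (_≡_; _≢_)
open import Algebra.Structures using (IsGroup)
open import Function.Bundles using (_⇔_)

card : ∀ {n} {P : Pred (Fin n) 0ℓ} → Decidable P → ℕ
card {n} P? = length (filter P? (allFin n))

record Incidence (np nl : ℕ) : Set₁ where
  field
    I  : Fin np → Fin nl → Set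
    I? : ∀ p L → Dec (I p L)

open Incidence public

-- p and q are collinear: some line is incident with both (so p ~ p).
Collinear : ∀ {np nl} → Incidence np nl → Fin np → Fin np → Set
Collinear 𝒮 p q = ∃[ L ] (I 𝒮 p L × I 𝒮 q L)

record IsGQ {np nl} (𝒮 : Incidence np nl) (s t : ℕ) : Set where
  field
    lineSize      : ∀ L → card (λ p → I? 𝒮 p L) ≡ suc s
    pointDegree   : ∀ p → card (λ L → I? 𝒮 p L) ≡ suc t
    partialLinear : ∀ p q L M → p ≢ q → I 𝒮 p L → I 𝒮 q L →
                    I 𝒮 p M → I 𝒮 q M → L ≡ M
    gqAxiom       : ∀ p L → ¬ I 𝒮 p L →
                    ∃! _≡_ (λ q → I 𝒮 q L × Collinear 𝒮 p q)

Thick : ℕ → ℕ → Set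
Thick s t = (2 ≤ s) × (2 ≤ t)

-- A finite group H = (Fin h, _∙_, ε, _⁻¹) acting faithfully on 𝒮 by
-- automorphisms, i.e. H is (identified with) a subgroup of Aut(𝒮).

record FinGroup (h : ℕ) : Set where
  field
    _∙_     : Fin h → Fin h → Fin h
    ε       : Fin h
    _⁻¹     : Fin h → Fin h
    isGroup : IsGroup _≡_ _∙_ ε _⁻¹

open FinGroup public

record AutAction {np nl h} (𝒮 : Incidence np nl) (G : FinGroup h) : Set where
  field
    onPt    : Fin h → Fin np → Fin np
    onLn    : Fin h → Fin nl → Fin nl
    preserves : ∀ g p L → I 𝒮 p L ⇔ I 𝒮 (onPt g p) (onLn g L)
    idPt    : ∀ p → onPt (ε G) p ≡ p
    idLn    : ∀ L → onLn (ε G) L ≡ L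
    mulPt   : ∀ g k p → onPt (_∙_ G g k) p ≡ onPt g (onPt k p)
    mulLn   : ∀ g k L → onLn (_∙_ G g k) L ≡ onLn g (onLn k L)
    faithful : ∀ g → (∀ p → onPt g p ≡ p) → (∀ L → onLn g L ≡ L) → g ≡ ε G

open AutAction public

record IsEGQ {np nl h} (𝒮 : Incidence np nl) (G : FinGroup h)
             (act : AutAction 𝒮 G) (x : Fin np) : Set where
  field
    fixesLinesThroughX : ∀ g L → I 𝒮 x L → onLn act g L ≡ L
    sharplyTransitive  : ∀ y z → ¬ Collinear 𝒮 x y → ¬ Collinear 𝒮 x z →
                         ∃! _≡_ (λ g → onPt act g y ≡ z)

IsSymmetry : ∀ {np nl h} {𝒮 : Incidence np nl} {G : FinGroup h} →
             AutAction 𝒮 G → Fin np → Fin h → Set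
IsSymmetry {𝒮 = 𝒮} act x g = ∀ p → Collinear 𝒮 x p → onPt act g p ≡ p

record HasSymmetryGroup {np nl h} {𝒮 : Incidence np nl} {G : FinGroup h}
       (act : AutAction 𝒮 G) (x : Fin np) (t : ℕ) : Set₁ where
  field
    S        : Pred (Fin h) 0ℓ
    S?       : Decidable S
    ε∈S      : S (ε G)
    ∙-closed : ∀ g k → S g → S k → S (_∙_ G g k)
    ⁻¹-closed : ∀ g → S g → S (_⁻¹ G g)
    size     : card S? ≡ t
    symm     : ∀ g → S g → IsSymmetry act x g

pow : ∀ {h} → FinGroup h → Fin h → ℕ → Fin h
pow G g zero    = ε G
pow G g (suc n) = _∙_ G g (pow G g n)

Stab : ∀ {np nl h} {𝒮 : Incidence np nl} {G : FinGroup h} →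
       AutAction 𝒮 G → Fin nl → Pred (Fin h) 0ℓ
Stab act L g = onLn act g L ≡ L

ElementaryAbelianStab : ∀ {np nl h} {𝒮 : Incidence np nl} {G : FinGroup h} →
                        AutAction 𝒮 G → Fin nl → Set
ElementaryAbelianStab {G = G} act L =
  (∀ g k → Stab act L g → Stab act L k → _∙_ G g k ≡ _∙_ G k g) ×
  ∃[ p ] (Prime p × (∀ g → Stab act L g → pow G g p ≡ ε G))

Central : ∀ {h} → FinGroup h → Pred (Fin h) 0ℓ
Central G g = ∀ k → _∙_ G g k ≡ _∙_ G k g

Central? : ∀ {h} (G : FinGroup h) → Decidable (Central G)
Central? G g = all? (λ k → _∙_ G g k ≟ _∙_ G k g)

RootElt : ∀ {np nl h} {𝒮 : Incidence np nl} {G : FinGroup h} →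
          AutAction 𝒮 G → Fin nl → Fin np → Pred (Fin h) 0ℓ
RootElt {𝒮 = 𝒮} act L q g = Stab act L g × (∀ M → I 𝒮 q M → onLn act g M ≡ M)

RootElt? : ∀ {np nl h} {𝒮 : Incidence np nl} {G : FinGroup h} →
           (act : AutAction 𝒮 G) → (L : Fin nl) → (q : Fin np) →
           Decidable (RootElt act L q)
RootElt? {𝒮 = 𝒮} act L q g =
  (onLn act g L ≟ L) ×-dec all? (λ M → I? 𝒮 q M →-dec (onLn act g M ≟ M))

{-# OPTIONS --safe #-}

-- Fix an affine point y. Write S for the symmetries about x and E for the elements of H mapping y to a
-- point collinear with y, i.e. the union of the stabilizers of the lines on y. Counting shows that S is
-- normal of order s, that H / S is abelian, that E meets each coset of S at most once, is closed under
-- squaring, and that each g ∉ S is a product of two elements of E in exactly s ways.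
--
-- Let C be the class of some g ∉ S. The pairs in E × E with product in C number |C| s, which is odd
-- because |H| = s³ is; so swapping the entries fixes some pair (e , e), and g is conjugate to e² ∈ E.
-- As all conjugates of g lie in g S, which meets E at most once, g is conjugate to every element of g S.
-- In particular Z(H) ≤ S.
--
-- Now S is central (cf. I. D. Macdonald's bounds for Camina p-groups): otherwise choose N normal in H,
-- N < S, with [S , H] N / N of prime order, let Z / N = S / N ∩ Z(H / N) and let E be the centralizer of
-- S / N in H. Counting commuting pairs gives |Z| |H| ≤ |E| |S| and |E|² ≤ |S| |H|, so |Z| = 1, but
-- Z > N. Hence the stabilizer of L, of order s, commutes with S, which is transitive on the affine lines
-- on q; so it fixes all of them, and |Z(H)| ≤ |S| = s.
module Submission where

-- The geometry enters through one fact: an element of `H` fixing two noncollinear points of x^⊥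
-- lies in `S`. So an element outside `S` fixes at most one of the `1 + s` common neighbours of x
-- and y, and a count makes it exactly one. Normality of `S` and commutativity of `H / S` rest on
-- this.
--
-- The swap works because `f e` is conjugate to `e f`, and because the number `s` of factorizations
-- is the same for `g` in `E` and for `g` outside both `E` and `S`.
--
-- Elementary abelian stabilizers supply the prime `p`: meeting `S` trivially, such a stabilizer
-- embeds in the abelian group `H / S`, so `s` and `|H|` are powers of `p`.
--
-- Let `E` now be the centralizer of `S / N`. In both counts of commuting pairs the generic
-- contributions cancel and only the exceptional ones survive: `Z` against `E` modulo `N`, then `E`
-- against `S` modulo `Z`. With `|H| = s³` they give `|E| ≤ s²` and `|Z| s³ ≤ s³`. Order `(s , s)`
-- thus leaves no room at all: one nontrivial element of `Z` is already a contradiction.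

open import Defs hiding (_∙_; ε; _⁻¹; isGroup)
open import Level using (0ℓ)
open import Algebra.Bundles using (Group)
open import Data.Bool using (Bool; true; false; if_then_else_)
open import Data.Empty using (⊥; ⊥-elim)
open import Data.Fin using (Fin; zero; suc; _≟_; toℕ; fromℕ<)
open import Data.Fin.Properties using (all?; any?; toℕ-fromℕ<; toℕ-injective; toℕ<n)
open import Data.List using (List; []; _∷_; length; filter; tabulate)
open import Data.Nat using (ℕ; zero; suc; pred; _+_; _*_; _∸_; _^_; _≤_; _<_; _%_; _/_; z≤n; s≤s; s≤s⁻¹; NonZero; >-nonZero; nonTrivial⇒n>1)
open import Data.Nat.Coprimality using (Coprime; coprime-Bézout; coprime-divisor; prime⇒coprime)
open import Data.Nat.DivMod using (m≡m%n+[m/n]*n; m%n<n)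
open import Data.Nat.Divisibility
  using (_∣_; _∣?_; divides; ∣m∣n⇒∣m+n; ∣m+n∣m⇒∣n; ∣m⇒∣m*n; ∣-trans; ∣-refl; ∣⇒≤; ∣1⇒≡1; *-cancelʳ-∣; *-monoˡ-∣; m∣m*n; n∣m⇒m%n≡0)
open import Data.Nat.GCD using (module Bézout)
open import Data.Nat.Primality using (Prime; prime[2]; euclidsLemma; prime⇒irreducible; prime⇒nonZero; prime⇒nonTrivial)
open import Data.Nat.Properties as ℕₚ using (module ≤-Reasoning)
open import Data.Nat.Solver using (module +-*-Solver)
open import Data.Product using (_×_; _,_; ∃; ∃-syntax; proj₁; proj₂)
open import Data.Sum using (inj₁; inj₂)
open import Data.Unit using (⊤; tt)
open import Data.Vec using (Vec; lookup)
open import Function using (_∘_; id; Equivalence)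
open import Relation.Binary.Definitions using (tri<; tri≈; tri>)
open import Relation.Binary.PropositionalEquality
  using (_≡_; _≢_; refl; sym; trans; cong; cong₂; subst; subst₂; module ≡-Reasoning)
open import Relation.Nullary using (¬_; Dec; yes; no; does; contradiction)
open import Relation.Nullary.Decidable using (_→-dec_; _×-dec_; ¬?; decidable-stable)
open import Relation.Unary using (Pred; Decidable)
open import Algebra.Properties.Semiring.Sum ℕₚ.+-*-semiring
  using (sum; sum-cong-≗; sum-replicate-zero; ∑-distrib-+; ∑-comm; *-distribˡ-sum; *-distribʳ-sum)
import Relation.Binary.Reasoning.Setoid
import Relation.Binary.Reflection

-- Counting

ind : {A : Set} → Dec A → ℕ
ind d = if does d then 1 else 0

ind-yes : {A : Set} (d : Dec A) → A → ind d ≡ 1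
ind-yes (yes _) _ = refl
ind-yes (no ¬a) a = contradiction a ¬a

ind-no : {A : Set} (d : Dec A) → ¬ A → ind d ≡ 0
ind-no (yes a) ¬a = contradiction a ¬a
ind-no (no _)  _  = refl

ind-mono : {A B : Set} (a : Dec A) (b : Dec B) → (A → B) → ind a ≤ ind b
ind-mono (yes a) b f = ℕₚ.≤-reflexive (sym (ind-yes b (f a)))
ind-mono (no _)  _ _ = z≤n

ind-split : {A B : Set} (a : Dec A) (b : Dec B) →
            ind a ≡ ind (a ×-dec b) + ind (a ×-dec ¬? b)
ind-split (no _)  _       = refl
ind-split (yes _) (yes _) = refl
ind-split (yes _) (no _)  = refl

sum-mono : ∀ {n} {f g : Fin n → ℕ} → (∀ i → f i ≤ g i) → sum f ≤ sum g
sum-mono {zero}  f≤g = z≤n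
sum-mono {suc n} f≤g = ℕₚ.+-mono-≤ (f≤g zero) (sum-mono (f≤g ∘ suc))

card≡sum : ∀ {n} {P : Pred (Fin n) 0ℓ} (P? : Decidable P) → card P? ≡ sum (λ i → ind (P? i))
card≡sum P? = go id
  where
  go : ∀ {k} (f : Fin k → Fin _) → length (filter P? (tabulate f)) ≡ sum (λ i → ind (P? (f i)))
  go {zero}  f = refl
  go {suc k} f with P? (f zero)
  ... | yes _ = cong suc (go (f ∘ suc))
  ... | no _  = go (f ∘ suc)

module _ {n} {P Q : Pred (Fin n) 0ℓ} (P? : Decidable P) (Q? : Decidable Q) where

  card-mono : (∀ i → P i → Q i) → card P? ≤ card Q?
  card-mono f = begin
    card P?                  ≡⟨ card≡sum P? ⟩
    sum (λ i → ind (P? i))   ≤⟨ sum-mono (λ i → ind-mono (P? i) (Q? i) (f i)) ⟩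
    sum (λ i → ind (Q? i))   ≡⟨ card≡sum Q? ⟨
    card Q?                  ∎
    where open ≤-Reasoning

  card-split : card P? ≡ card (λ i → P? i ×-dec Q? i) + card (λ i → P? i ×-dec ¬? (Q? i))
  card-split = begin
    card P?
      ≡⟨ card≡sum P? ⟩
    sum (λ i → ind (P? i))
      ≡⟨ sum-cong-≗ (λ i → ind-split (P? i) (Q? i)) ⟩
    sum (λ i → ind (P? i ×-dec Q? i) + ind (P? i ×-dec ¬? (Q? i)))
      ≡⟨ ∑-distrib-+ (λ i → ind (P? i ×-dec Q? i)) (λ i → ind (P? i ×-dec ¬? (Q? i))) ⟩
    sum (λ i → ind (P? i ×-dec Q? i)) + sum (λ i → ind (P? i ×-dec ¬? (Q? i)))
      ≡⟨ cong₂ _+_ (card≡sum (λ i → P? i ×-dec Q? i)) (card≡sum (λ i → P? i ×-dec ¬? (Q? i))) ⟨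
    card (λ i → P? i ×-dec Q? i) + card (λ i → P? i ×-dec ¬? (Q? i)) ∎
    where open ≡-Reasoning

card-cong : ∀ {n} {P Q : Pred (Fin n) 0ℓ} (P? : Decidable P) (Q? : Decidable Q) →
            (∀ i → P i → Q i) → (∀ i → Q i → P i) → card P? ≡ card Q?
card-cong P? Q? f g = ℕₚ.≤-antisym (card-mono P? Q? f) (card-mono Q? P? g)

module _ {n m} {P P₁ : Pred (Fin n) 0ℓ} {Q Q₁ : Pred (Fin m) 0ℓ}
         (P? : Decidable P) (P₁? : Decidable P₁) (Q? : Decidable Q) (Q₁? : Decidable Q₁)
         {R : Fin n → Fin m → Set} (R? : ∀ i j → Dec (R i j)) where

  private
    row : Fin n → ℕ
    row i = card (λ j → Q? j ×-dec R? i j)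

    col : Fin m → ℕ
    col j = card (λ i → P? i ×-dec R? i j)

    card-swap : sum (λ i → ind (P? i) * row i) ≡ sum (λ j → ind (Q? j) * col j)
    card-swap = begin
      sum (λ i → ind (P? i) * row i)
        ≡⟨ sum-cong-≗ (λ i → trans (cong (ind (P? i) *_) (card≡sum (λ j → Q? j ×-dec R? i j)))
                                   (*-distribˡ-sum (ind (P? i)) (λ j → ind (Q? j ×-dec R? i j)))) ⟩
      sum (λ i → sum (λ j → ind (P? i) * ind (Q? j ×-dec R? i j)))
        ≡⟨ sum-cong-≗ (λ i → sum-cong-≗ (λ j → weight i j)) ⟩
      sum (λ i → sum (λ j → ind (Q? j) * ind (P? i ×-dec R? i j)))
        ≡⟨ ∑-comm (λ i j → ind (Q? j) * ind (P? i ×-dec R? i j)) ⟩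
      sum (λ j → sum (λ i → ind (Q? j) * ind (P? i ×-dec R? i j)))
        ≡⟨ sum-cong-≗ (λ j → trans (cong (ind (Q? j) *_) (card≡sum (λ i → P? i ×-dec R? i j)))
                                   (*-distribˡ-sum (ind (Q? j)) (λ i → ind (P? i ×-dec R? i j)))) ⟨
      sum (λ j → ind (Q? j) * col j) ∎
      where
      open ≡-Reasoning
      weight : ∀ i j → ind (P? i) * ind (Q? j ×-dec R? i j) ≡ ind (Q? j) * ind (P? i ×-dec R? i j)
      weight i j with P? i | Q? j | R? i j
      ... | yes _ | yes _ | yes _ = refl
      ... | yes _ | yes _ | no _  = refl
      ... | yes _ | no _  | yes _ = refl
      ... | yes _ | no _  | no _  = refl
      ... | no _  | yes _ | yes _ = refl
      ... | no _  | yes _ | no _  = refl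
      ... | no _  | no _  | yes _ = refl
      ... | no _  | no _  | no _  = refl

    lower : ∀ {A B : Set} (p : Dec A) (q : Dec B) {a d c} → (B → A) →
            (A → a ≤ c) → (B → a + d ≤ c) → a * ind p + d * ind q ≤ ind p * c
    lower (no ¬a) (yes b) B⇒A _ _ = contradiction (B⇒A b) ¬a
    lower (no _)  (no _)  {a} {d} _ _ _ rewrite ℕₚ.*-zeroʳ a | ℕₚ.*-zeroʳ d = z≤n
    lower (yes x) (no _)  {a} {d} {c} _ h _
      rewrite ℕₚ.*-identityʳ a | ℕₚ.*-zeroʳ d | ℕₚ.+-identityʳ a | ℕₚ.+-identityʳ c = h x
    lower (yes _) (yes b) {a} {d} {c} _ _ h
      rewrite ℕₚ.*-identityʳ a | ℕₚ.*-identityʳ d | ℕₚ.+-identityʳ c = h b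

    upper : ∀ {A B : Set} (p : Dec A) (q : Dec B) {a d c} →
            (A → ¬ B → c ≤ a) → (A → B → c ≤ a + d) → ind p * c ≤ a * ind p + d * ind q
    upper (no _)  _       _ _ = z≤n
    upper (yes x) (no ¬b) {a} {d} {c} h _
      rewrite ℕₚ.*-identityʳ a | ℕₚ.*-zeroʳ d | ℕₚ.+-identityʳ a | ℕₚ.+-identityʳ c = h x ¬b
    upper (yes x) (yes b) {a} {d} {c} _ h
      rewrite ℕₚ.*-identityʳ a | ℕₚ.*-identityʳ d | ℕₚ.+-identityʳ c = h x b

    linear : ∀ {k} {X Y : Pred (Fin k) 0ℓ} (X? : Decidable X) (Y? : Decidable Y) a d →
             sum (λ i → a * ind (X? i) + d * ind (Y? i)) ≡ card X? * a + card Y? * d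
    linear X? Y? a d = begin
      sum (λ i → a * ind (X? i) + d * ind (Y? i))
        ≡⟨ ∑-distrib-+ (λ i → a * ind (X? i)) (λ i → d * ind (Y? i)) ⟩
      sum (λ i → a * ind (X? i)) + sum (λ i → d * ind (Y? i))
        ≡⟨ cong₂ _+_ (*-distribˡ-sum a (λ i → ind (X? i))) (*-distribˡ-sum d (λ i → ind (Y? i))) ⟨
      a * sum (λ i → ind (X? i)) + d * sum (λ i → ind (Y? i))
        ≡⟨ cong₂ (λ u v → a * u + d * v) (card≡sum X?) (card≡sum Y?) ⟨
      a * card X? + d * card Y?
        ≡⟨ cong₂ _+_ (ℕₚ.*-comm a _) (ℕₚ.*-comm d _) ⟩
      card X? * a + card Y? * d ∎
      where open ≡-Reasoning

    scale : ∀ {n} (k : ℕ) (f g : Fin n → ℕ) → sum (λ i → f i * (k * g i)) ≡ k * sum (λ i → f i * g i)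
    scale k f g = begin
      sum (λ i → f i * (k * g i))  ≡⟨ sum-cong-≗ (λ i → solve 3 (λ a b c → a :* (b :* c) := b :* (a :* c)) refl (f i) k (g i)) ⟩
      sum (λ i → k * (f i * g i))  ≡⟨ *-distribˡ-sum k (λ i → f i * g i) ⟨
      k * sum (λ i → f i * g i)    ∎
      where
      open ≡-Reasoning
      open +-*-Solver

  -- P₁ and Q₁ are the exceptional rows and columns; k clears denominators.
  weighted-double-count : ∀ k a d b e →
    (∀ i → P₁ i → P i) →
    (∀ i → P i → a ≤ k * card (λ j → Q? j ×-dec R? i j)) →
    (∀ i → P₁ i → a + d ≤ k * card (λ j → Q? j ×-dec R? i j)) →
    (∀ j → Q j → ¬ Q₁ j → k * card (λ i → P? i ×-dec R? i j) ≤ b) →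
    (∀ j → Q j → Q₁ j → k * card (λ i → P? i ×-dec R? i j) ≤ b + e) →
    card P? * a + card P₁? * d ≤ card Q? * b + card Q₁? * e
  weighted-double-count k a d b e P₁⊆P rows rows₁ cols cols₁ = begin
    card P? * a + card P₁? * d
      ≡⟨ linear P? P₁? a d ⟨
    sum (λ i → a * ind (P? i) + d * ind (P₁? i))
      ≤⟨ sum-mono (λ i → lower (P? i) (P₁? i) (P₁⊆P i) (rows i) (rows₁ i)) ⟩
    sum (λ i → ind (P? i) * (k * row i))
      ≡⟨ scale k (λ i → ind (P? i)) row ⟩
    k * sum (λ i → ind (P? i) * row i)
      ≡⟨ cong (k *_) card-swap ⟩
    k * sum (λ j → ind (Q? j) * col j)
      ≡⟨ scale k (λ j → ind (Q? j)) col ⟨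
    sum (λ j → ind (Q? j) * (k * col j))
      ≤⟨ sum-mono (λ j → upper (Q? j) (Q₁? j) (cols j) (cols₁ j)) ⟩
    sum (λ j → b * ind (Q? j) + e * ind (Q₁? j))
      ≡⟨ linear Q? Q₁? b e ⟩
    card Q? * b + card Q₁? * e ∎
    where open ≤-Reasoning

⊥? : ∀ {n} → Decidable {A = Fin n} (λ _ → ⊥)
⊥? _ = no λ ()

⊤? : ∀ {n} → Decidable {A = Fin n} (λ _ → ⊤)
⊤? _ = yes tt

module _ {n m} {P : Pred (Fin n) 0ℓ} {Q : Pred (Fin m) 0ℓ} (P? : Decidable P) (Q? : Decidable Q)
         {R : Fin n → Fin m → Set} (R? : ∀ i j → Dec (R i j)) where

  double-count : ∀ a b →
    (∀ i → P i → a ≤ card (λ j → Q? j ×-dec R? i j)) →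
    (∀ j → Q j → card (λ i → P? i ×-dec R? i j) ≤ b) →
    card P? * a ≤ card Q? * b
  double-count a b rows cols = begin
    card P? * a
      ≤⟨ ℕₚ.m≤m+n _ _ ⟩
    card P? * a + card (⊥? {n}) * 0
      ≤⟨ weighted-double-count P? ⊥? Q? ⊥? R? 1 a 0 b 0 (λ _ ())
           (λ i p → ℕₚ.≤-trans (rows i p) (ℕₚ.m≤m+n _ 0)) (λ _ ())
           (λ j q _ → subst (_≤ b) (sym (ℕₚ.+-identityʳ _)) (cols j q)) (λ _ _ ()) ⟩
    card Q? * b + card (⊥? {m}) * 0
      ≡⟨ cong (card Q? * b +_) (ℕₚ.*-zeroʳ (card (⊥? {m}))) ⟩
    card Q? * b + 0
      ≡⟨ ℕₚ.+-identityʳ _ ⟩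
    card Q? * b ∎
    where open ≤-Reasoning

card-⊤ : ∀ {n} → card (⊤? {n}) ≡ n
card-⊤ {n} = trans (card≡sum (⊤? {n})) (ones n)
  where
  ones : ∀ n → sum {n} (λ i → ind (⊤? i)) ≡ n
  ones zero    = refl
  ones (suc n) = cong suc (ones n)

sum-pick : ∀ {n} (f : Fin n → ℕ) i → f i ≤ sum f
sum-pick f zero    = ℕₚ.m≤m+n _ _
sum-pick f (suc i) = ℕₚ.≤-trans (sum-pick (f ∘ suc) i) (ℕₚ.m≤n+m _ _)

module _ {n} {P : Pred (Fin n) 0ℓ} (P? : Decidable P) where

  card-pos : ∀ i → P i → 1 ≤ card P?
  card-pos i p = begin
    1                       ≡⟨ ind-yes (P? i) p ⟨
    ind (P? i)              ≤⟨ sum-pick (λ i → ind (P? i)) i ⟩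
    sum (λ i → ind (P? i))  ≡⟨ card≡sum P? ⟨
    card P?                 ∎
    where open ≤-Reasoning

  card-≡0 : (∀ i → ¬ P i) → card P? ≡ 0
  card-≡0 none = trans (card≡sum P?)
    (trans (sum-cong-≗ (λ i → ind-no (P? i) (none i))) (sum-replicate-zero n))

  card-positive⇒∃ : 1 ≤ card P? → ∃[ i ] P i
  card-positive⇒∃ 1≤c with any? P?
  ... | yes e = e
  ... | no ¬e = contradiction (subst (1 ≤_) (card-≡0 (λ i p → ¬e (i , p))) 1≤c) λ ()

card-≟ : ∀ {n} (i : Fin n) → card (_≟ i) ≡ 1
card-≟ {n} i = trans (card≡sum (_≟ i)) (go i)
  where
  go : ∀ {n} (i : Fin n) → sum (λ j → ind (j ≟ i)) ≡ 1
  go {suc n} zero    = cong suc (sum-replicate-zero n)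
  go {suc n} (suc i) = trans (sum-cong-≗ (λ j → cong-suc j)) (go i)
    where
    cong-suc : ∀ j → ind (suc j ≟ suc i) ≡ ind (j ≟ i)
    cong-suc j with j ≟ i
    ... | yes _ = refl
    ... | no _  = refl

module _ {n} {P : Pred (Fin n) 0ℓ} (P? : Decidable P) where

  card-unique : (∀ i j → P i → P j → i ≡ j) → card P? ≤ 1
  card-unique unique with any? P?
  ... | no ¬e      = subst (_≤ 1) (sym (card-≡0 P? (λ i p → ¬e (i , p)))) z≤n
  ... | yes (i , p) = subst (card P? ≤_) (card-≟ i) (card-mono P? (_≟ i) (λ j q → unique j i q p))

  card-remove : ∀ i → P i → card P? ≡ suc (card (λ j → P? j ×-dec ¬? (j ≟ i)))
  card-remove i p = trans (card-split P? (_≟ i)) (cong (_+ card (λ j → P? j ×-dec ¬? (j ≟ i)))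
    (trans (card-cong (λ j → P? j ×-dec (j ≟ i)) (_≟ i) (λ _ → proj₂) (λ { _ refl → p , refl })) (card-≟ i)))

  another : 2 ≤ card P? → ∀ i → ∃[ j ] (P j × j ≢ i)
  another 2≤c i with any? (λ j → P? j ×-dec ¬? (j ≟ i))
  ... | yes e = e
  ... | no ¬e = contradiction (ℕₚ.≤-trans 2≤c (card-unique (λ j k p q → trans (eq j p) (sym (eq k q))))) λ { (s≤s ()) }
    where
    eq : ∀ j → P j → j ≡ i
    eq j p = decidable-stable (j ≟ i) (λ j≢i → ¬e (j , p , j≢i))

module _ {n} {P Q : Pred (Fin n) 0ℓ} (P? : Decidable P) (Q? : Decidable Q) where

  ⊆∧card-≥⇒⊇ : (∀ i → Q i → P i) → card P? ≤ card Q? → ∀ i → P i → Q i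
  ⊆∧card-≥⇒⊇ Q⊆P P≤Q i p with Q? i
  ... | yes q = q
  ... | no ¬q = contradiction (begin-strict
    card Q?                                                             ≤⟨ card-mono Q? (λ i → P? i ×-dec Q? i) (λ i q → Q⊆P i q , q) ⟩
    card (λ i → P? i ×-dec Q? i)                                        <⟨ ℕₚ.m<m+n _ (card-pos (λ i → P? i ×-dec ¬? (Q? i)) i (p , ¬q)) ⟩
    card (λ i → P? i ×-dec Q? i) + card (λ i → P? i ×-dec ¬? (Q? i))    ≡⟨ card-split P? Q? ⟨
    card P?                                                             ∎)
    (ℕₚ.≤⇒≯ P≤Q)
    where open ≤-Reasoning

  card-strict : (∀ i → Q i → P i) → ∀ i → P i → ¬ Q i → card Q? < card P?
  card-strict Q⊆P i p ¬q = ℕₚ.≰⇒> (λ P≤Q → ¬q (⊆∧card-≥⇒⊇ Q⊆P P≤Q i p))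

card-≤ : ∀ {n} {P : Pred (Fin n) 0ℓ} (P? : Decidable P) → card P? ≤ n
card-≤ {n} P? = subst (card P? ≤_) (card-⊤ {n}) (card-mono P? ⊤? (λ _ _ → tt))

card-inj : ∀ {n m} {P : Pred (Fin n) 0ℓ} {Q : Pred (Fin m) 0ℓ} (P? : Decidable P) (Q? : Decidable Q)
           (f : Fin n → Fin m) → (∀ i → P i → Q (f i)) →
           (∀ i j → P i → P j → f i ≡ f j → i ≡ j) → card P? ≤ card Q?
card-inj P? Q? f P⇒Q inj = subst₂ _≤_ (ℕₚ.*-identityʳ _) (ℕₚ.*-identityʳ _)
  (double-count P? Q? (λ i j → f i ≟ j) 1 1
    (λ i p → card-pos (λ j → Q? j ×-dec (f i ≟ j)) (f i) (P⇒Q i p , refl))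
    (λ j _ → card-unique (λ i → P? i ×-dec (f i ≟ j))
      (λ { i i′ (p , e) (p′ , e′) → inj i i′ p p′ (trans e (sym e′)) })))

-- Strip off one class at a time, by induction on a bound for the cardinality. The equivalence laws
-- are asked for on `P` only, so they pass to what remains, where by transitivity the other classes
-- are intact.
partition-∣ : ∀ {n} {P : Pred (Fin n) 0ℓ} (P? : Decidable P)
  {R : Fin n → Fin n → Set} (R? : ∀ i j → Dec (R i j)) (d : ℕ) →
  (∀ i → P i → R i i) →
  (∀ i j → P i → P j → R i j → R j i) →
  (∀ i j k → P i → P j → P k → R i j → R j k → R i k) →
  (∀ i → P i → d ∣ card (λ j → P? j ×-dec R? i j)) →
  d ∣ card P?
partition-∣ {n} P? {R} R? d rfl sm tr cls = go (card P?) P? rfl sm tr cls ℕₚ.≤-refl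
  where
  go : ∀ bound {P : Pred (Fin n) 0ℓ} (P? : Decidable P) →
    (∀ i → P i → R i i) →
    (∀ i j → P i → P j → R i j → R j i) →
    (∀ i j k → P i → P j → P k → R i j → R j k → R i k) →
    (∀ i → P i → d ∣ card (λ j → P? j ×-dec R? i j)) →
    card P? ≤ bound → d ∣ card P?
  go bound P? rfl sm tr cls c≤b with any? P?
  go bound P? rfl sm tr cls c≤b | no ¬e =
    subst (d ∣_) (sym (card-≡0 P? (λ i p → ¬e (i , p)))) (divides 0 refl)
  go zero P? rfl sm tr cls c≤b | yes (i , p) =
    contradiction (ℕₚ.≤-trans (card-pos P? i p) c≤b) λ ()
  go (suc bound) P? rfl sm tr cls c≤b | yes (i , p) =
    subst (d ∣_) (sym (card-split P? (R? i))) (∣m∣n⇒∣m+n (cls i p)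
      (go bound P′? (λ j → rfl j ∘ proj₁) (λ j k p q → sm j k (proj₁ p) (proj₁ q))
        (λ j k l p q r → tr j k l (proj₁ p) (proj₁ q) (proj₁ r)) cls′ smaller))
    where
    P′? = λ j → P? j ×-dec ¬? (R? i j)
    cls′ : ∀ k → _ → d ∣ card (λ j → P′? j ×-dec R? k j)
    cls′ k (pk , ¬ik) = subst (d ∣_)
      (card-cong (λ j → P? j ×-dec R? k j) (λ j → P′? j ×-dec R? k j)
        (λ j (pj , kj) → (pj , λ ij → ¬ik (tr i j k p pj pk ij (sm k j pk pj kj))) , kj)
        (λ j ((pj , _) , kj) → pj , kj))
      (cls k pk)
    smaller : card P′? ≤ bound
    smaller = s≤s⁻¹ (begin
      suc (card P′?)                                   ≤⟨ ℕₚ.+-monoˡ-≤ _ (card-pos (λ j → P? j ×-dec R? i j) i (p , rfl i p)) ⟩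
      card (λ j → P? j ×-dec R? i j) + card P′?        ≡⟨ card-split P? (R? i) ⟨
      card P?                                          ≤⟨ c≤b ⟩
      suc bound                                        ∎)
      where open ≤-Reasoning

-- The terms at `(i , j)` and `(j , i)` pair up. Here `f` will count ordered pairs of factors, and
-- the zero diagonal says that the swap fixes none of them.
symmetric-sum-even : ∀ {n} (f : Fin n → Fin n → ℕ) → (∀ i j → f i j ≡ f j i) → (∀ i → f i i ≡ 0) →
                     2 ∣ sum (λ i → sum (f i))
symmetric-sum-even {zero}  f _ _ = divides 0 refl
symmetric-sum-even {suc n} f sm diag = subst (2 ∣_) (sym eq)
  (∣m∣n⇒∣m+n (m∣m*n A)
    (symmetric-sum-even (λ i j → f (suc i) (suc j)) (λ i j → sm (suc i) (suc j)) (diag ∘ suc)))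
  where
  open ≡-Reasoning
  A = sum (λ j → f zero (suc j))
  C = sum (λ i → sum (λ j → f (suc i) (suc j)))
  eq : f zero zero + A + sum (λ i → sum (f (suc i))) ≡ 2 * A + C
  eq = begin
    f zero zero + A + sum (λ i → sum (f (suc i)))
      ≡⟨ cong₂ (λ u v → u + A + v) (diag zero) (∑-distrib-+ (λ i → f (suc i) zero) (λ i → sum (λ j → f (suc i) (suc j)))) ⟩
    A + (sum (λ i → f (suc i) zero) + C)
      ≡⟨ cong (λ u → A + (u + C)) (sum-cong-≗ (λ i → sm (suc i) zero)) ⟩
    A + (A + C)
      ≡⟨ solve 2 (λ a c → a :+ (a :+ c) := con 2 :* a :+ c) refl A C ⟩
    2 * A + C ∎
    where open +-*-Solver

-- Gives a bound on `P` access to a base point in `P`, as is needed to translate a coset into its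
-- subgroup. An empty `P` satisfies every bound.
card-bounded : ∀ {n} {P : Pred (Fin n) 0ℓ} (P? : Decidable P) {c} → (∀ i → P i → card P? ≤ c) → card P? ≤ c
card-bounded P? {c} bound with any? P?
... | yes (i , p) = bound i p
... | no none     = subst (_≤ c) (sym (card-≡0 P? (λ i p → none (i , p)))) z≤n

card-two : ∀ {n} {P : Pred (Fin n) 0ℓ} (P? : Decidable P) i j → P i → P j → j ≢ i → 2 ≤ card P?
card-two P? i j p q j≢i = subst (2 ≤_) (sym (card-remove P? i p))
  (s≤s (card-pos (λ j → P? j ×-dec ¬? (j ≟ i)) j (q , j≢i)))

square-cancel-≤ : ∀ {m n} → m * m ≤ n * n → m ≤ n
square-cancel-≤ {m} {n} m²≤n² = ℕₚ.≮⇒≥ (λ n<m → contradiction m²≤n² (ℕₚ.<⇒≱ (ℕₚ.*-mono-< n<m n<m)))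

module _ {n m} {P : Pred (Fin n) 0ℓ} {Q : Pred (Fin m) 0ℓ} (P? : Decidable P) (Q? : Decidable Q)
         {R : Fin n → Fin m → Set} (R? : ∀ i j → Dec (R i j)) where

  double-count-≡ : ∀ a b →
    (∀ i → P i → card (λ j → Q? j ×-dec R? i j) ≡ a) →
    (∀ j → Q j → card (λ i → P? i ×-dec R? i j) ≡ b) →
    card P? * a ≡ card Q? * b
  double-count-≡ a b rows cols = ℕₚ.≤-antisym
    (double-count P? Q? R? a b (λ i p → ℕₚ.≤-reflexive (sym (rows i p))) (λ j q → ℕₚ.≤-reflexive (cols j q)))
    (double-count Q? P? (λ j i → R? i j) b a (λ j q → ℕₚ.≤-reflexive (sym (cols j q))) (λ i p → ℕₚ.≤-reflexive (rows i p)))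

  -- A bijection presented as a relation, total and single-valued in both directions, so that
  -- incidence can be used directly.
  correspondence :
    (∀ i → P i → ∃[ j ] (Q j × R i j)) → (∀ i j k → P i → Q j → Q k → R i j → R i k → j ≡ k) →
    (∀ j → Q j → ∃[ i ] (P i × R i j)) → (∀ j i k → Q j → P i → P k → R i j → R k j → i ≡ k) →
    card P? ≡ card Q?
  correspondence f f! g g! = subst₂ _≡_ (ℕₚ.*-identityʳ _) (ℕₚ.*-identityʳ _) (double-count-≡ 1 1
    (λ i p → let j , q , r = f i p in ℕₚ.≤-antisym
      (card-unique (λ j → Q? j ×-dec R? i j) (λ j k (q , r) (q′ , r′) → f! i j k p q q′ r r′))
      (card-pos (λ j → Q? j ×-dec R? i j) j (q , r)))
    (λ j q → let i , p , r = g j q in ℕₚ.≤-antisym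
      (card-unique (λ i → P? i ×-dec R? i j) (λ i k (p , r) (p′ , r′) → g! j i k q p p′ r r′))
      (card-pos (λ i → P? i ×-dec R? i j) i (p , r))))

-- Groups

module GroupSolver {c ℓ} (𝒢 : Group c ℓ) where

  open Group 𝒢 renaming (refl to ≈-refl; sym to ≈-sym; trans to ≈-trans)
  open import Algebra.Properties.Group 𝒢 using (⁻¹-anti-homo-∙; ⁻¹-involutive; ε⁻¹≈ε)
  open Relation.Binary.Reasoning.Setoid setoid

  infixl 7 _⊕_
  infix 8 ⊖_

  data Expr (n : ℕ) : Set where
    var : Fin n → Expr n
    :ε  : Expr n
    _⊕_ : Expr n → Expr n → Expr n
    ⊖_  : Expr n → Expr n

  ⟦_⟧ : ∀ {n} → Expr n → Vec Carrier n → Carrier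
  ⟦ var i ⟧ ρ = lookup ρ i
  ⟦ :ε ⟧    ρ = ε
  ⟦ a ⊕ b ⟧ ρ = ⟦ a ⟧ ρ ∙ ⟦ b ⟧ ρ
  ⟦ ⊖ a ⟧   ρ = ⟦ a ⟧ ρ ⁻¹

  Letter : ℕ → Set
  Letter n = Bool × Fin n

  letter : ∀ {n} → Vec Carrier n → Letter n → Carrier
  letter ρ (true  , i) = lookup ρ i
  letter ρ (false , i) = lookup ρ i ⁻¹

  word : ∀ {n} → Vec Carrier n → List (Letter n) → Carrier
  word ρ []      = ε
  word ρ (l ∷ w) = letter ρ l ∙ word ρ w

  -- One free cancellation at the front suffices: `norm` adds letters one by one to a reduced word,
  -- so the result is the reduced word of the free group, and every identity valid in all groups
  -- reduces to `refl`.
  push : ∀ {n} → Letter n → List (Letter n) → List (Letter n)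
  push l [] = l ∷ []
  push (true , i) ((false , j) ∷ w) = if does (i ≟ j) then w else (true , i) ∷ (false , j) ∷ w
  push (false , i) ((true , j) ∷ w) = if does (i ≟ j) then w else (false , i) ∷ (true , j) ∷ w
  push l w = l ∷ w

  push-correct : ∀ {n} (ρ : Vec Carrier n) l w → word ρ (push l w) ≈ letter ρ l ∙ word ρ w
  push-correct ρ (true  , i) [] = ≈-refl
  push-correct ρ (false , i) [] = ≈-refl
  push-correct ρ (true  , i) ((true  , j) ∷ w) = ≈-refl
  push-correct ρ (false , i) ((false , j) ∷ w) = ≈-refl
  push-correct ρ (true  , i) ((false , j) ∷ w) with i ≟ j
  ... | no _     = ≈-refl
  ... | yes refl = begin
    word ρ w                                         ≈⟨ identityˡ _ ⟨
    ε ∙ word ρ w                                     ≈⟨ ∙-congʳ (inverseʳ _) ⟨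
    lookup ρ i ∙ lookup ρ i ⁻¹ ∙ word ρ w            ≈⟨ assoc _ _ _ ⟩
    lookup ρ i ∙ (lookup ρ i ⁻¹ ∙ word ρ w)          ∎
  push-correct ρ (false , i) ((true  , j) ∷ w) with i ≟ j
  ... | no _     = ≈-refl
  ... | yes refl = begin
    word ρ w                                         ≈⟨ identityˡ _ ⟨
    ε ∙ word ρ w                                     ≈⟨ ∙-congʳ (inverseˡ _) ⟨
    lookup ρ i ⁻¹ ∙ lookup ρ i ∙ word ρ w            ≈⟨ assoc _ _ _ ⟩
    lookup ρ i ⁻¹ ∙ (lookup ρ i ∙ word ρ w)          ∎

  mutual
    norm : ∀ {n} → Expr n → List (Letter n) → List (Letter n)
    norm (var i) w = push (true , i) w
    norm :ε      w = w
    norm (a ⊕ b) w = norm a (norm b w)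
    norm (⊖ a)   w = norm⁻ a w

    norm⁻ : ∀ {n} → Expr n → List (Letter n) → List (Letter n)
    norm⁻ (var i) w = push (false , i) w
    norm⁻ :ε      w = w
    norm⁻ (a ⊕ b) w = norm⁻ b (norm⁻ a w)
    norm⁻ (⊖ a)   w = norm a w

  mutual
    norm-correct : ∀ {n} (ρ : Vec Carrier n) a w → word ρ (norm a w) ≈ ⟦ a ⟧ ρ ∙ word ρ w
    norm-correct ρ (var i) w = push-correct ρ (true , i) w
    norm-correct ρ :ε      w = ≈-sym (identityˡ _)
    norm-correct ρ (a ⊕ b) w = begin
      word ρ (norm a (norm b w))          ≈⟨ norm-correct ρ a _ ⟩
      ⟦ a ⟧ ρ ∙ word ρ (norm b w)         ≈⟨ ∙-congˡ (norm-correct ρ b w) ⟩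
      ⟦ a ⟧ ρ ∙ (⟦ b ⟧ ρ ∙ word ρ w)      ≈⟨ assoc _ _ _ ⟨
      ⟦ a ⟧ ρ ∙ ⟦ b ⟧ ρ ∙ word ρ w        ∎
    norm-correct ρ (⊖ a)   w = norm⁻-correct ρ a w

    norm⁻-correct : ∀ {n} (ρ : Vec Carrier n) a w → word ρ (norm⁻ a w) ≈ ⟦ a ⟧ ρ ⁻¹ ∙ word ρ w
    norm⁻-correct ρ (var i) w = push-correct ρ (false , i) w
    norm⁻-correct ρ :ε      w = ≈-sym (≈-trans (∙-congʳ ε⁻¹≈ε) (identityˡ _))
    norm⁻-correct ρ (a ⊕ b) w = begin
      word ρ (norm⁻ b (norm⁻ a w))            ≈⟨ norm⁻-correct ρ b _ ⟩
      ⟦ b ⟧ ρ ⁻¹ ∙ word ρ (norm⁻ a w)         ≈⟨ ∙-congˡ (norm⁻-correct ρ a w) ⟩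
      ⟦ b ⟧ ρ ⁻¹ ∙ (⟦ a ⟧ ρ ⁻¹ ∙ word ρ w)    ≈⟨ assoc _ _ _ ⟨
      ⟦ b ⟧ ρ ⁻¹ ∙ ⟦ a ⟧ ρ ⁻¹ ∙ word ρ w      ≈⟨ ∙-congʳ (⁻¹-anti-homo-∙ _ _) ⟨
      (⟦ a ⟧ ρ ∙ ⟦ b ⟧ ρ) ⁻¹ ∙ word ρ w       ∎
    norm⁻-correct ρ (⊖ a)   w = ≈-trans (norm-correct ρ a w) (∙-congʳ (≈-sym (⁻¹-involutive _)))

  open Relation.Binary.Reflection setoid var ⟦_⟧ (λ a ρ → word ρ (norm a []))
    (λ a ρ → ≈-trans (norm-correct ρ a []) (identityʳ _)) public using (solve; _⊜_)

-- Stated over a setoid, because these lemmas are applied in quotients, where equality is congruence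
-- modulo a normal subgroup.
module GroupLemmas {c ℓ} (𝒢 : Group c ℓ) where

  open Group 𝒢 renaming (refl to ≈-refl; sym to ≈-sym; trans to ≈-trans)
  open GroupSolver 𝒢
  open Relation.Binary.Reasoning.Setoid setoid

  commutes-∙ : ∀ g a b → g ∙ a ≈ a ∙ g → g ∙ b ≈ b ∙ g → g ∙ (a ∙ b) ≈ a ∙ b ∙ g
  commutes-∙ g a b ga gb = begin
    g ∙ (a ∙ b)  ≈⟨ assoc g a b ⟨
    g ∙ a ∙ b    ≈⟨ ∙-congʳ ga ⟩
    a ∙ g ∙ b    ≈⟨ assoc a g b ⟩
    a ∙ (g ∙ b)  ≈⟨ ∙-congˡ gb ⟩
    a ∙ (b ∙ g)  ≈⟨ assoc a b g ⟨
    a ∙ b ∙ g    ∎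

  commutes-⁻¹ : ∀ g a → g ∙ a ≈ a ∙ g → g ∙ a ⁻¹ ≈ a ⁻¹ ∙ g
  commutes-⁻¹ g a ga = begin
    g ∙ a ⁻¹                  ≈⟨ solve 2 (λ g a → g ⊕ ⊖ a ⊜ ⊖ a ⊕ (a ⊕ g) ⊕ ⊖ a) ≈-refl g a ⟩
    a ⁻¹ ∙ (a ∙ g) ∙ a ⁻¹     ≈⟨ ∙-congʳ (∙-congˡ ga) ⟨
    a ⁻¹ ∙ (g ∙ a) ∙ a ⁻¹     ≈⟨ solve 2 (λ g a → ⊖ a ⊕ (g ⊕ a) ⊕ ⊖ a ⊜ ⊖ a ⊕ g) ≈-refl g a ⟩
    a ⁻¹ ∙ g                  ∎

  commutes-ε : ∀ g → g ∙ ε ≈ ε ∙ g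
  commutes-ε g = ≈-trans (identityʳ g) (≈-sym (identityˡ g))

  commutes⇒conj : ∀ g a → g ∙ a ≈ a ∙ g → g ∙ a ∙ g ⁻¹ ≈ a
  commutes⇒conj g a ga = ≈-trans (∙-congʳ ga) (solve 2 (λ a g → a ⊕ g ⊕ ⊖ g ⊜ a) ≈-refl a g)

  conj⇒commutes : ∀ g a → g ∙ a ∙ g ⁻¹ ≈ a → g ∙ a ≈ a ∙ g
  conj⇒commutes g a e = ≈-trans (solve 2 (λ a g → g ⊕ a ⊜ g ⊕ a ⊕ ⊖ g ⊕ g) ≈-refl a g) (∙-congʳ e)

  conj-cong : ∀ g {a b} → a ≈ b → g ∙ a ∙ g ⁻¹ ≈ g ∙ b ∙ g ⁻¹
  conj-cong g a≈b = ∙-congʳ (∙-congˡ a≈b)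

  conj-∙ : ∀ g k a → g ∙ k ∙ a ∙ (g ∙ k) ⁻¹ ≈ g ∙ (k ∙ a ∙ k ⁻¹) ∙ g ⁻¹
  conj-∙ = solve 3 (λ g k a → g ⊕ k ⊕ a ⊕ ⊖ (g ⊕ k) ⊜ g ⊕ (k ⊕ a ⊕ ⊖ k) ⊕ ⊖ g) ≈-refl

  conj-⁻¹ : ∀ g {a b} → g ∙ a ∙ g ⁻¹ ≈ b → a ≈ g ⁻¹ ∙ b ∙ g ⁻¹ ⁻¹
  conj-⁻¹ g {a} e = ≈-trans (solve 2 (λ g a → a ⊜ ⊖ g ⊕ (g ⊕ a ⊕ ⊖ g) ⊕ ⊖ (⊖ g)) ≈-refl g a) (conj-cong (g ⁻¹) e)

  -- Conjugation by `g` multiplies `b′ ∙ b` and `b ∙ b′` by the same factor `u′ ∙ u`, which commutes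
  -- with both and drops out of their quotient. This is the source of the centrality of commutators
  -- in `[E,E]⊆Z`.
  conj-commutator : ∀ g b b′ u u′ → g ∙ b ∙ g ⁻¹ ≈ b ∙ u → g ∙ b′ ∙ g ⁻¹ ≈ b′ ∙ u′ →
    b ∙ u ≈ u ∙ b → b ∙ u′ ≈ u′ ∙ b → b′ ∙ u ≈ u ∙ b′ → b′ ∙ u′ ≈ u′ ∙ b′ → u ∙ u′ ≈ u′ ∙ u →
    g ∙ ((b′ ∙ b) ⁻¹ ∙ (b ∙ b′)) ∙ g ⁻¹ ≈ (b′ ∙ b) ⁻¹ ∙ (b ∙ b′)
  conj-commutator g b b′ u u′ gb gb′ bu bu′ b′u b′u′ uu′ = begin
    g ∙ ((b′ ∙ b) ⁻¹ ∙ (b ∙ b′)) ∙ g ⁻¹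
      ≈⟨ solve 3 (λ g b b′ → g ⊕ (⊖ (b′ ⊕ b) ⊕ (b ⊕ b′)) ⊕ ⊖ g
           ⊜ ⊖ ((g ⊕ b′ ⊕ ⊖ g) ⊕ (g ⊕ b ⊕ ⊖ g)) ⊕ ((g ⊕ b ⊕ ⊖ g) ⊕ (g ⊕ b′ ⊕ ⊖ g))) ≈-refl g b b′ ⟩
    ((g ∙ b′ ∙ g ⁻¹) ∙ (g ∙ b ∙ g ⁻¹)) ⁻¹ ∙ ((g ∙ b ∙ g ⁻¹) ∙ (g ∙ b′ ∙ g ⁻¹))
      ≈⟨ ∙-cong (⁻¹-cong (≈-trans (∙-cong gb′ gb) (shuffle b′ b u′ u bu′)))
                (≈-trans (∙-cong gb gb′) (≈-trans (shuffle b b′ u u′ b′u) (∙-congˡ uu′))) ⟩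
    (b′ ∙ b ∙ (u′ ∙ u)) ⁻¹ ∙ (b ∙ b′ ∙ (u′ ∙ u))
      ≈⟨ ∙-cong (⁻¹-cong (comm (u′ ∙ u) b′ b b′-w b-w)) (comm (u′ ∙ u) b b′ b-w b′-w) ⟩
    ((u′ ∙ u) ∙ (b′ ∙ b)) ⁻¹ ∙ ((u′ ∙ u) ∙ (b ∙ b′))
      ≈⟨ solve 3 (λ w c d → ⊖ (w ⊕ c) ⊕ (w ⊕ d) ⊜ ⊖ c ⊕ d) ≈-refl (u′ ∙ u) (b′ ∙ b) (b ∙ b′) ⟩
    (b′ ∙ b) ⁻¹ ∙ (b ∙ b′) ∎
    where
    shuffle : ∀ a c v w → c ∙ v ≈ v ∙ c → a ∙ v ∙ (c ∙ w) ≈ a ∙ c ∙ (v ∙ w)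
    shuffle a c v w cv = begin
      a ∙ v ∙ (c ∙ w)    ≈⟨ solve 4 (λ a v c w → a ⊕ v ⊕ (c ⊕ w) ⊜ a ⊕ (v ⊕ c) ⊕ w) ≈-refl a v c w ⟩
      a ∙ (v ∙ c) ∙ w    ≈⟨ ∙-congʳ (∙-congˡ cv) ⟨
      a ∙ (c ∙ v) ∙ w    ≈⟨ solve 4 (λ a v c w → a ⊕ (c ⊕ v) ⊕ w ⊜ a ⊕ c ⊕ (v ⊕ w)) ≈-refl a v c w ⟩
      a ∙ c ∙ (v ∙ w)    ∎
    comm : ∀ w a c → w ∙ a ≈ a ∙ w → w ∙ c ≈ c ∙ w → a ∙ c ∙ w ≈ w ∙ (a ∙ c)
    comm w a c wa wc = ≈-sym (commutes-∙ w a c wa wc)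
    b-w : u′ ∙ u ∙ b ≈ b ∙ (u′ ∙ u)
    b-w = ≈-sym (commutes-∙ b u′ u bu′ bu)
    b′-w : u′ ∙ u ∙ b′ ≈ b′ ∙ (u′ ∙ u)
    b′-w = ≈-sym (commutes-∙ b′ u′ u b′u′ b′u)

-- If `p` does not divide `m`, then `m` is coprime to `p`, and the factors `p` can be removed from
-- the power until `m` divides 1.
prime∣prime-power-divisor : ∀ {p} → Prime p → ∀ k {m} → m ∣ p ^ k → m ≢ 1 → p ∣ m
prime∣prime-power-divisor pr zero m∣1 m≢1 = contradiction (∣1⇒≡1 m∣1) m≢1
prime∣prime-power-divisor {p} pr (suc k) {m} m∣p^k m≢1 with p ∣? m
... | yes p∣m = p∣m
... | no  p∤m = prime∣prime-power-divisor pr k (coprime-divisor coprime m∣p^k) m≢1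
  where
  coprime : Coprime m p
  coprime (d∣m , d∣p) with prime⇒irreducible pr d∣p
  ... | inj₁ d≡1 = d≡1
  ... | inj₂ d≡p = contradiction (subst (_∣ m) d≡p d∣m) p∤m

-- Subgroups, quotients and conjugacy classes of a finite group

module FiniteGroup {h} (G : FinGroup h) where

  𝒢 : Group 0ℓ 0ℓ
  𝒢 = record { isGroup = FinGroup.isGroup G }

  open Group 𝒢 public using (_∙_; ε; _⁻¹; assoc; identityˡ; identityʳ; inverseˡ; inverseʳ)
  open import Algebra.Properties.Group 𝒢 public using (∙-cancelˡ; ∙-cancelʳ; ε⁻¹≈ε)
  open GroupSolver 𝒢 public

  record Subgroup : Set₁ where
    field
      Mem  : Pred (Fin h) 0ℓ
      Mem? : Decidable Mem
      ε∈   : Mem ε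
      ∙∈   : ∀ {a b} → Mem a → Mem b → Mem (a ∙ b)
      ⁻¹∈  : ∀ {a} → Mem a → Mem (a ⁻¹)

    size : ℕ
    size = card Mem?

    size-pos : 1 ≤ size
    size-pos = card-pos Mem? ε ε∈

    pow∈ : ∀ {a} n → Mem a → Mem (pow G a n)
    pow∈ zero    _  = ε∈
    pow∈ (suc n) a∈ = ∙∈ a∈ (pow∈ n a∈)

    coset-size : ∀ u → card (λ w → Mem? (u ⁻¹ ∙ w)) ≡ size
    coset-size u = ℕₚ.≤-antisym
      (card-inj _ Mem? (u ⁻¹ ∙_) (λ _ m → m) (λ w w′ _ _ → ∙-cancelˡ (u ⁻¹) w w′))
      (card-inj Mem? _ (u ∙_)
        (λ w → subst Mem (solve 2 (λ u w → w ⊜ ⊖ u ⊕ (u ⊕ w)) refl u w))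
        (λ w w′ _ _ → ∙-cancelˡ u w w′))

  open Subgroup public using () renaming (Mem to _∋_; Mem? to _∋?_; size to order)

  _⊆_ : Subgroup → Subgroup → Set
  K ⊆ L = ∀ a → K ∋ a → L ∋ a

  whole : Subgroup
  whole = record { Mem = λ _ → ⊤ ; Mem? = ⊤? ; ε∈ = tt ; ∙∈ = λ _ _ → tt ; ⁻¹∈ = λ _ → tt }

  lagrange : ∀ K L → K ⊆ L → order K ∣ order L
  lagrange K L K⊆L = partition-∣ (L ∋?_) (λ u w → K.Mem? (u ⁻¹ ∙ w)) (order K)
    (λ u _ → subst K.Mem (sym (inverseˡ u)) K.ε∈)
    (λ u w _ _ m → subst K.Mem (solve 2 (λ u w → ⊖ (⊖ u ⊕ w) ⊜ ⊖ w ⊕ u) refl u w) (K.⁻¹∈ m))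
    (λ u v w _ _ _ m n → subst K.Mem
      (solve 3 (λ u v w → (⊖ u ⊕ v) ⊕ (⊖ v ⊕ w) ⊜ ⊖ u ⊕ w) refl u v w) (K.∙∈ m n))
    (λ u u∈ → subst (order K ∣_) (trans (sym (K.coset-size u))
      (card-cong (λ w → K.Mem? (u ⁻¹ ∙ w)) (λ w → L ∋? w ×-dec K.Mem? (u ⁻¹ ∙ w))
        (λ w m → subst (L ∋_) (solve 2 (λ u w → u ⊕ (⊖ u ⊕ w) ⊜ w) refl u w) (L.∙∈ u∈ (K⊆L _ m)) , m)
        (λ w → proj₂))) ∣-refl)
    where
    module K = Subgroup K
    module L = Subgroup L

  lagrange-whole : ∀ K → order K ∣ h
  lagrange-whole K = subst (order K ∣_) card-⊤ (lagrange K whole (λ _ _ → tt))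

  module _ {p} (pr : Prime p) where

    private instance
      p≢0 : NonZero p
      p≢0 = prime⇒nonZero pr

    -- The index `m` divides a power of `p` and differs from 1.
    proper-subgroup-∣ : ∀ K L → K ⊆ L → ∀ k → order L ∣ p ^ k → ∀ u → L ∋ u → ¬ K ∋ u →
                        p * order K ∣ order L
    proper-subgroup-∣ K L K⊆L k L∣ u u∈L u∉K = go (lagrange K L K⊆L)
      where
      go : order K ∣ order L → p * order K ∣ order L
      go (divides m eq) = subst (p * order K ∣_) (sym eq) (*-monoˡ-∣ (order K)
        (prime∣prime-power-divisor pr k (∣-trans (subst (m ∣_) (sym eq) (m∣m*n (order K))) L∣)
          λ m≡1 → u∉K (⊆∧card-≥⇒⊇ (L ∋?_) (K ∋?_) K⊆L
            (ℕₚ.≤-reflexive (trans eq (trans (cong (_* order K) m≡1) (ℕₚ.*-identityˡ _)))) u u∈L)))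

    proper-subgroup-≤ : ∀ K L → K ⊆ L → ∀ k → order L ∣ p ^ k → ∀ u → L ∋ u → ¬ K ∋ u →
                        p * order K ≤ order L
    proper-subgroup-≤ K L K⊆L k L∣ u u∈L u∉K =
      ∣⇒≤ {{>-nonZero (Subgroup.size-pos L)}} (proper-subgroup-∣ K L K⊆L k L∣ u u∈L u∉K)

  record NormalSubgroup : Set₁ where
    field
      subgroup : Subgroup
      conj∈    : ∀ g {a} → subgroup ∋ a → subgroup ∋ (g ∙ a ∙ g ⁻¹)
    open Subgroup subgroup public

  pow-+ : ∀ a m n → pow G a (m + n) ≡ pow G a m ∙ pow G a n
  pow-+ a zero    n = sym (identityˡ _)
  pow-+ a (suc m) n = trans (cong (a ∙_) (pow-+ a m n)) (sym (assoc _ _ _))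

  pow-* : ∀ a m n → pow G a (n * m) ≡ pow G (pow G a m) n
  pow-* a m zero    = refl
  pow-* a m (suc n) = trans (pow-+ a m (n * m)) (cong (pow G a m ∙_) (pow-* a m n))

  conj-pow : ∀ g a n → pow G (g ∙ a ∙ g ⁻¹) n ≡ g ∙ pow G a n ∙ g ⁻¹
  conj-pow g a zero    = solve 1 (λ g → :ε ⊜ g ⊕ :ε ⊕ ⊖ g) refl g
  conj-pow g a (suc n) = trans (cong (g ∙ a ∙ g ⁻¹ ∙_) (conj-pow g a n))
    (solve 3 (λ g a b → g ⊕ a ⊕ ⊖ g ⊕ (g ⊕ b ⊕ ⊖ g) ⊜ g ⊕ (a ⊕ b) ⊕ ⊖ g) refl g a (pow G a n))

  trivial : NormalSubgroup
  trivial = record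
    { subgroup = record
        { Mem = _≡ ε ; Mem? = _≟ ε ; ε∈ = refl
        ; ∙∈ = λ { refl refl → identityˡ ε } ; ⁻¹∈ = λ { refl → ε⁻¹≈ε } }
    ; conj∈ = λ { g refl → solve 1 (λ g → g ⊕ :ε ⊕ ⊖ g ⊜ :ε) refl g } }

  -- The quotient G / N, with the elements of G as carrier.
  module Quotient (N : NormalSubgroup) where

    open NormalSubgroup N

    infix 4 _≈_ _≈?_

    _≈_ : Fin h → Fin h → Set
    a ≈ b = Mem (a ⁻¹ ∙ b)

    _≈?_ : ∀ a b → Dec (a ≈ b)
    a ≈? b = Mem? (a ⁻¹ ∙ b)

    ≡⇒≈ : ∀ {a b} → a ≡ b → a ≈ b
    ≡⇒≈ {a} refl = subst Mem (sym (inverseˡ a)) ε∈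

    quotient : Group 0ℓ 0ℓ
    quotient = record
      { _≈_ = _≈_ ; _∙_ = _∙_ ; ε = ε ; _⁻¹ = _⁻¹
      ; isGroup = record
        { isMonoid = record
          { isSemigroup = record
            { isMagma = record
              { isEquivalence = record
                { refl  = ≡⇒≈ refl
                ; sym   = λ {a} {b} m → subst Mem (solve 2 (λ a b → ⊖ (⊖ a ⊕ b) ⊜ ⊖ b ⊕ a) refl a b) (⁻¹∈ m)
                ; trans = λ {a} {b} {c} m n → subst Mem
                    (solve 3 (λ a b c → (⊖ a ⊕ b) ⊕ (⊖ b ⊕ c) ⊜ ⊖ a ⊕ c) refl a b c) (∙∈ m n) }
              ; ∙-cong = λ {a} {b} {c} {d} m n → subst Mem
                  (solve 4 (λ a b c d → ⊖ c ⊕ (⊖ a ⊕ b) ⊕ ⊖ (⊖ c) ⊕ (⊖ c ⊕ d) ⊜ ⊖ (a ⊕ c) ⊕ (b ⊕ d)) refl a b c d)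
                  (∙∈ (conj∈ (c ⁻¹) m) n) }
            ; assoc = λ a b c → ≡⇒≈ (assoc a b c) }
          ; identity = (λ a → ≡⇒≈ (identityˡ a)) , (λ a → ≡⇒≈ (identityʳ a)) }
        ; inverse = (λ a → ≡⇒≈ (inverseˡ a)) , (λ a → ≡⇒≈ (inverseʳ a))
        ; ⁻¹-cong = λ {a} {b} m → subst Mem
            (solve 2 (λ a b → a ⊕ (⊖ (⊖ a ⊕ b)) ⊕ ⊖ a ⊜ ⊖ (⊖ a) ⊕ ⊖ b) refl a b) (conj∈ a (⁻¹∈ m)) } }

    open Group quotient public using (∙-cong; ∙-congˡ; ∙-congʳ; ⁻¹-cong)
      renaming (refl to ≈-refl; sym to ≈-sym; trans to ≈-trans; setoid to ≈-setoid)
    open GroupLemmas quotient public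

    ∈⇒≈ε : ∀ {a} → Mem a → a ≈ ε
    ∈⇒≈ε {a} m = subst Mem (sym (identityʳ _)) (⁻¹∈ m)

    ≈∈ : ∀ {a b} → a ≈ b → Mem a → Mem b
    ≈∈ {a} {b} a≈b a∈ = subst Mem (solve 2 (λ a b → a ⊕ (⊖ a ⊕ b) ⊜ b) refl a b) (∙∈ a∈ a≈b)

    Commute : Fin h → Fin h → Set
    Commute g k = g ∙ k ≈ k ∙ g

    Commute? : ∀ g k → Dec (Commute g k)
    Commute? g k = g ∙ k ≈? k ∙ g

    -- The full preimage in `G` of the centralizer of `g N`. Here and below sizes count elements of
    -- `G`, so they carry a factor `|N|`.
    centralizer : Fin h → Subgroup
    centralizer g = record
      { Mem = Commute g ; Mem? = Commute? g ; ε∈ = commutes-ε g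
      ; ∙∈ = λ {a} {b} → commutes-∙ g a b ; ⁻¹∈ = λ {a} → commutes-⁻¹ g a }

    CentralMod : Pred (Fin h) 0ℓ
    CentralMod u = ∀ g → Commute u g

    CentralMod? : Decidable CentralMod
    CentralMod? u = all? (λ g → Commute? u g)

    Conj : Fin h → Fin h → Set
    Conj u w = ∃[ g ] (w ≈ g ∙ u ∙ g ⁻¹)

    Conj? : ∀ u w → Dec (Conj u w)
    Conj? u w = any? (λ g → w ≈? g ∙ u ∙ g ⁻¹)

    Conj-refl : ∀ u → Conj u u
    Conj-refl u = ε , ≡⇒≈ (solve 1 (λ u → u ⊜ :ε ⊕ u ⊕ ⊖ :ε) refl u)

    Conj-sym : ∀ {u w} → Conj u w → Conj w u
    Conj-sym (g , e) = g ⁻¹ , conj-⁻¹ g (≈-sym e)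

    Conj-trans : ∀ {u v w} → Conj u v → Conj v w → Conj u w
    Conj-trans {u} (g , e) (k , f) = k ∙ g , ≈-trans f (≈-trans (conj-cong k e) (≈-sym (conj-∙ k g u)))

    -- Orbit-stabilizer, by counting the pairs `(w , g)` with `w ≈ g ∙ u ∙ g ⁻¹`: the `g` for a
    -- given `w` form a coset of the centralizer, the `w` for a given `g` a coset of `N`.
    class-equation : ∀ u → card (Conj? u) * order (centralizer u) ≡ h * size
    class-equation u = trans
      (ℕₚ.≤-antisym
        (double-count (Conj? u) (⊤? {h}) R? _ _
          (λ w c → ℕₚ.≤-reflexive (sym (row w c))) (λ g _ → ℕₚ.≤-reflexive (column g)))
        (double-count (⊤? {h}) (Conj? u) (λ g w → R? w g) _ _
          (λ g _ → ℕₚ.≤-reflexive (sym (column g))) (λ w c → ℕₚ.≤-reflexive (row w c))))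
      (cong (_* size) (card-⊤ {h}))
      where
      R? : ∀ w g → Dec (w ≈ g ∙ u ∙ g ⁻¹)
      R? w g = w ≈? g ∙ u ∙ g ⁻¹
      row : ∀ w → Conj u w → card (λ g → ⊤? g ×-dec R? w g) ≡ order (centralizer u)
      row w (g , e) = trans
        (card-cong (λ k → ⊤? k ×-dec R? w k) (λ k → Commute? u (g ⁻¹ ∙ k))
          (λ k (_ , f) → ≈-sym (conj⇒commutes (g ⁻¹ ∙ k) u (≈-trans (conj-∙ (g ⁻¹) k u)
              (≈-sym (conj-⁻¹ g (≈-trans (≈-sym e) f))))))
          (λ k c → tt , ≈-trans e (≈-trans (≈-sym (conj-cong g (commutes⇒conj (g ⁻¹ ∙ k) u (≈-sym c))))
              (≡⇒≈ (solve 3 (λ g k u → g ⊕ ((⊖ g ⊕ k) ⊕ u ⊕ ⊖ (⊖ g ⊕ k)) ⊕ ⊖ g ⊜ k ⊕ u ⊕ ⊖ k) refl g k u)))))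
        (Subgroup.coset-size (centralizer u) g)
      column : ∀ g → card (λ w → Conj? u w ×-dec R? w g) ≡ size
      column g = trans
        (card-cong (λ w → Conj? u w ×-dec R? w g) (λ w → Mem? ((g ∙ u ∙ g ⁻¹) ⁻¹ ∙ w))
          (λ w (_ , e) → ≈-sym e) (λ w e → (g , ≈-sym e) , ≈-sym e))
        (coset-size (g ∙ u ∙ g ⁻¹))

    module _ {p} (pr : Prime p) {k} (h≡ : h ≡ p ^ k) where

      private instance
        p≢0 : NonZero p
        p≢0 = prime⇒nonZero pr

      class-size-∣ : ∀ u → ¬ CentralMod u → p * size ∣ card (Conj? u)
      class-size-∣ u ¬central with any? (λ g → ¬? (Commute? u g))
      ... | no none = contradiction (λ g → decidable-stable (Commute? u g) (λ ¬c → none (g , ¬c))) ¬central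
      ... | yes (g , ¬c) = go (proper-subgroup-∣ pr (centralizer u) whole (λ _ _ → tt) k
                                (subst (_∣ p ^ k) (trans (sym h≡) (sym (card-⊤ {h}))) ∣-refl) g tt ¬c)
        where
        open ≡-Reasoning
        open +-*-Solver using (_:*_; _:=_)
        C = order (centralizer u)
        go : p * C ∣ order whole → p * size ∣ card (Conj? u)
        go (divides m eq) = *-cancelʳ-∣ C {{>-nonZero (Subgroup.size-pos (centralizer u))}}
          (divides m (begin
            card (Conj? u) * C    ≡⟨ class-equation u ⟩
            h * size              ≡⟨ cong (_* size) (trans (sym (card-⊤ {h})) eq) ⟩
            m * (p * C) * size    ≡⟨ +-*-Solver.solve 4 (λ m p c n → m :* (p :* c) :* n := m :* (p :* n :* c)) refl m p C size ⟩
            m * (p * size * C)    ∎))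

      -- A p-group acting on the nontrivial p-group M / N has nontrivial fixed points.
      ∃-central : ∀ (M : NormalSubgroup) → subgroup ⊆ NormalSubgroup.subgroup M →
        ∀ u → NormalSubgroup.Mem M u → ¬ Mem u →
        ∃[ v ] (NormalSubgroup.Mem M v × ¬ Mem v × CentralMod v)
      ∃-central M N⊆M u u∈M u∉N with any? (λ v → NormalSubgroup.Mem? M v ×-dec ¬? (Mem? v) ×-dec CentralMod? v)
      ... | yes e = e
      ... | no ¬e = contradiction (∣⇒≤ {{>-nonZero size-pos}} p*size∣size) (ℕₚ.<⇒≱
              (subst (_< p * size) (ℕₚ.*-identityˡ size)
                (ℕₚ.*-monoˡ-< size {{>-nonZero size-pos}} (nonTrivial⇒n>1 p {{prime⇒nonTrivial pr}}))))
        where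
        module M = NormalSubgroup M
        fixed : ∀ w → M.Mem w → CentralMod w → Mem w
        fixed w w∈ cw = decidable-stable (Mem? w) (λ w∉ → ¬e (w , w∈ , w∉ , cw))
        p*size∣M : p * size ∣ M.size
        p*size∣M = proper-subgroup-∣ pr subgroup M.subgroup N⊆M k (subst (M.size ∣_) h≡ (lagrange-whole M.subgroup)) u u∈M u∉N
        -- If no fixed point exists, `M` without `N` splits into noncentral classes, each of size
        -- divisible by `p * size`. As `p * size` also divides `|M|`, it would divide `|N|`, which
        -- is smaller.
        X? = λ w → M.Mem? w ×-dec ¬? (Mem? w)
        conj∈M : ∀ {v w} → M.Mem v → Conj v w → M.Mem w
        conj∈M {v} {w} v∈ (g , e) = subst M.Mem (solve 2 (λ a w → a ⊕ ⊖ (⊖ w ⊕ a) ⊜ w) refl (g ∙ v ∙ g ⁻¹) w)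
          (M.∙∈ (M.conj∈ g v∈) (M.⁻¹∈ (N⊆M _ e)))
        conj∈N : ∀ {v w} → Conj v w → Mem v → Mem w
        conj∈N (g , e) v∈ = ≈∈ (≈-sym e) (conj∈ g v∈)
        p*size∣X : p * size ∣ card X?
        p*size∣X = partition-∣ X? Conj? (p * size)
          (λ v _ → Conj-refl v) (λ _ _ _ _ → Conj-sym) (λ _ _ _ _ _ _ → Conj-trans)
          (λ v (v∈M , v∉N) → subst (p * size ∣_)
            (card-cong (Conj? v) (λ w → X? w ×-dec Conj? v w)
              (λ w c → (conj∈M v∈M c , λ w∈ → v∉N (conj∈N (Conj-sym c) w∈)) , c) (λ _ → proj₂))
            (class-size-∣ v (λ c → v∉N (fixed v v∈M c))))
        p*size∣size : p * size ∣ size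
        p*size∣size = ∣m+n∣m⇒∣n (subst (p * size ∣_)
          (trans (card-split M.Mem? Mem?) (trans (ℕₚ.+-comm _ (card X?))
            (cong (card X? +_) (card-cong (λ w → M.Mem? w ×-dec Mem? w) Mem? (λ _ → proj₂) (λ w w∈ → N⊆M w w∈ , w∈)))))
          p*size∣M) p*size∣X

-- Adjoining one element to a normal subgroup, and products of subgroups

module Extensions {h} (G : FinGroup h) where

  open FiniteGroup G

  -- Bézout with natural coefficients: one multiple of `m` or `n` exceeds a multiple of the other by
  -- 1, whence the two cases.
  coprime-pow∈ : ∀ K a m n → Coprime m n → K ∋ pow G a m → K ∋ pow G a n → K ∋ a
  coprime-pow∈ K a m n c m∈ n∈ = go (coprime-Bézout c)
    where
    open Subgroup K
    multiple : ∀ m x → Mem (pow G a m) → Mem (pow G a (x * m))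
    multiple m x m∈ = subst Mem (sym (pow-* a m x)) (pow∈ x m∈)
    cancelʳ∈ : ∀ {b} → Mem b → Mem (a ∙ b) → Mem a
    cancelʳ∈ {b} b∈ ab∈ = subst Mem (solve 2 (λ a b → a ⊕ b ⊕ ⊖ b ⊜ a) refl a b) (∙∈ ab∈ (⁻¹∈ b∈))
    go : Bézout.Identity 1 m n → Mem a
    go (Bézout.+- x y eq) = cancelʳ∈ (multiple n y n∈) (subst (Mem ∘ pow G a) (sym eq) (multiple m x m∈))
    go (Bézout.-+ x y eq) = cancelʳ∈ (multiple m x m∈) (subst (Mem ∘ pow G a) (sym eq) (multiple n y n∈))

  -- The preimage of the cyclic subgroup of `G / N` generated by `v`. Membership is recorded by an
  -- exponent below `p`, so it is decidable and also yields the `p` representatives on which later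
  -- counting relies.
  module Adjoin (N : NormalSubgroup) {p} (pr : Prime p) (v : Fin h)
    (v-central : Quotient.CentralMod N v) (vᵖ∈N : NormalSubgroup.Mem N (pow G v p)) where

    open NormalSubgroup N
    open Quotient N

    private
      instance
        p≢0 : NonZero p
        p≢0 = prime⇒nonZero pr

      v^_ : ℕ → Fin h
      v^ n = pow G v n

      v^-central : ∀ n → CentralMod (v^ n)
      v^-central zero    g = ≈-sym (commutes-ε g)
      v^-central (suc n) g = ≈-sym (commutes-∙ g v (v^ n) (≈-sym (v-central g)) (≈-sym (v^-central n g)))

      v^multiple : ∀ m → Mem (v^ (m * p))
      v^multiple m = subst Mem (sym (pow-* v p m)) (pow∈ m vᵖ∈N)

      Mem′ : Pred (Fin h) 0ℓ
      Mem′ g = ∃ λ (i : Fin p) → v^ (toℕ i) ≈ g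

      power∈ : ∀ n {g} → v^ n ≈ g → Mem′ g
      power∈ n e = fromℕ< (m%n<n n p) , ≈-trans (≡⇒≈ (cong v^_ (toℕ-fromℕ< (m%n<n n p)))) (≈-trans reduce e)
        where
        reduce : v^ (n % p) ≈ v^ n
        reduce = subst Mem (trans (solve 2 (λ a b → b ⊜ ⊖ a ⊕ (a ⊕ b)) refl (v^ (n % p)) (v^ (n / p * p)))
                   (cong (v^ (n % p) ⁻¹ ∙_) (trans (sym (pow-+ v (n % p) (n / p * p)))
                     (cong v^_ (sym (m≡m%n+[m/n]*n n p))))))
                   (v^multiple (n / p))

      inverse-power : ∀ n → v^ n ⁻¹ ≈ v^ (n * pred p)
      inverse-power n = subst Mem (trans (cong v^_ eq) (trans (pow-+ v n (n * pred p))
          (cong (_∙ v^ (n * pred p)) (solve 1 (λ a → a ⊜ ⊖ (⊖ a)) refl (v^ n)))))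
        (v^multiple n)
        where
        eq : n * p ≡ n + n * pred p
        eq = trans (cong (n *_) (sym (ℕₚ.suc-pred p))) (ℕₚ.*-suc n (pred p))

    adjoin : NormalSubgroup
    adjoin = record
      { subgroup = record
        { Mem = Mem′ ; Mem? = λ g → any? (λ i → v^ (toℕ i) ≈? g) ; ε∈ = power∈ 0 ≈-refl
        ; ∙∈ = λ (i , e) (j , f) → power∈ (toℕ i + toℕ j) (≈-trans (≡⇒≈ (pow-+ v (toℕ i) (toℕ j))) (∙-cong e f))
        ; ⁻¹∈ = λ (i , e) → power∈ (toℕ i * pred p) (≈-trans (≈-sym (inverse-power (toℕ i))) (⁻¹-cong e)) }
      ; conj∈ = λ g (i , e) → i , ≈-trans (≈-sym (commutes⇒conj g _ (≈-sym (v^-central (toℕ i) g)))) (conj-cong g e) }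

    base⊆adjoin : subgroup ⊆ NormalSubgroup.subgroup adjoin
    base⊆adjoin g g∈ = power∈ 0 (≈-sym (∈⇒≈ε g∈))

    v∈adjoin : NormalSubgroup.Mem adjoin v
    v∈adjoin = power∈ 1 (≡⇒≈ (identityʳ v))

    adjoin-least : ∀ K → subgroup ⊆ K → K ∋ v → NormalSubgroup.subgroup adjoin ⊆ K
    adjoin-least K N⊆K v∈K g (i , e) = subst (K ∋_) (solve 2 (λ a b → a ⊕ (⊖ a ⊕ b) ⊜ b) refl (v^ (toℕ i)) g)
      (Subgroup.∙∈ K (Subgroup.pow∈ K (toℕ i) v∈K) (N⊆K _ e))

    -- The cosets of `1, v, ..., v^(p-1)` are distinct: otherwise some `v^(j-i)` with
    -- `0 < j - i < p` lies in `N`, and with `v^p` in `N` coprimality puts `v` itself there.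
    order-adjoin : ¬ Mem v → NormalSubgroup.size adjoin ≡ p * size
    order-adjoin v∉N = ℕₚ.≤-antisym
      (subst₂ _≤_ (ℕₚ.*-identityʳ _) (cong (_* size) (card-⊤ {p}))
        (double-count Adj? (⊤? {p}) R? 1 size
          (λ g (i , e) → card-pos (λ i → ⊤? i ×-dec R? g i) i (tt , e))
          (λ i _ → ℕₚ.≤-reflexive (column i))))
      (subst₂ _≤_ (cong (_* size) (card-⊤ {p})) (ℕₚ.*-identityʳ _)
        (double-count (⊤? {p}) Adj? (λ i g → R? g i) size 1
          (λ i _ → ℕₚ.≤-reflexive (sym (column i)))
          (λ g _ → card-unique (λ i → ⊤? i ×-dec R? g i)
            (λ i j (_ , e) (_ , f) → toℕ-injective (unique (toℕ i) (toℕ j) (toℕ<n i) (toℕ<n j) (≈-trans e (≈-sym f)))))))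
      where
      Adj? = NormalSubgroup.Mem? adjoin
      R? : ∀ g (i : Fin p) → Dec (v^ (toℕ i) ≈ g)
      R? g i = v^ (toℕ i) ≈? g
      column : ∀ i → card (λ g → Adj? g ×-dec R? g i) ≡ size
      column i = trans (card-cong (λ g → Adj? g ×-dec R? g i) (λ g → Mem? (v^ (toℕ i) ⁻¹ ∙ g))
        (λ _ → proj₂) (λ g e → (i , e) , e)) (coset-size (v^ (toℕ i)))
      distinct : ∀ {i j} → i < j → j < p → ¬ v^ i ≈ v^ j
      distinct {i} {j} i<j j<p e = v∉N (coprime-pow∈ subgroup v p (j ∸ i)
        (prime⇒coprime pr {{>-nonZero (ℕₚ.m<n⇒0<n∸m i<j)}} (ℕₚ.≤-<-trans (ℕₚ.m∸n≤m j i) j<p)) vᵖ∈N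
        (subst Mem (trans (cong (λ n → v^ i ⁻¹ ∙ v^ n) (sym (ℕₚ.m+[n∸m]≡n (ℕₚ.<⇒≤ i<j))))
          (trans (cong (v^ i ⁻¹ ∙_) (pow-+ v i (j ∸ i)))
            (solve 2 (λ a b → ⊖ a ⊕ (a ⊕ b) ⊜ b) refl (v^ i) (v^ (j ∸ i))))) e))
      unique : ∀ i j → i < p → j < p → v^ i ≈ v^ j → i ≡ j
      unique i j i<p j<p e with ℕₚ.<-cmp i j
      ... | tri< i<j _ _ = contradiction e (distinct i<j j<p)
      ... | tri≈ _ i≡j _ = i≡j
      ... | tri> _ _ j<i = contradiction (≈-sym e) (distinct j<i i<p)

  module Product (A : Subgroup) (S : NormalSubgroup) where

    private
      module A = Subgroup A
      module S = NormalSubgroup S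

      Mem′ : Pred (Fin h) 0ℓ
      Mem′ g = ∃[ a ] (A.Mem a × S.Mem (a ⁻¹ ∙ g))

    A∙S : Subgroup
    A∙S = record
      { Mem = Mem′ ; Mem? = λ g → any? (λ a → A.Mem? a ×-dec S.Mem? (a ⁻¹ ∙ g))
      ; ε∈ = ε , A.ε∈ , subst S.Mem (sym (inverseˡ ε)) S.ε∈
      ; ∙∈ = λ {g} {k} (a , a∈ , m) (b , b∈ , n) → a ∙ b , A.∙∈ a∈ b∈ , subst S.Mem
          (solve 4 (λ a b g k → ⊖ b ⊕ (⊖ a ⊕ g) ⊕ ⊖ (⊖ b) ⊕ (⊖ b ⊕ k) ⊜ ⊖ (a ⊕ b) ⊕ (g ⊕ k)) refl a b g k)
          (S.∙∈ (S.conj∈ (b ⁻¹) m) n)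
      ; ⁻¹∈ = λ {g} (a , a∈ , m) → a ⁻¹ , A.⁻¹∈ a∈ , subst S.Mem
          (solve 2 (λ a g → a ⊕ ⊖ (⊖ a ⊕ g) ⊕ ⊖ a ⊜ ⊖ (⊖ a) ⊕ ⊖ g) refl a g) (S.conj∈ a (S.⁻¹∈ m)) }

    A⊆A∙S : A ⊆ A∙S
    A⊆A∙S a a∈ = a , a∈ , subst S.Mem (sym (inverseˡ a)) S.ε∈

    S⊆A∙S : S.subgroup ⊆ A∙S
    S⊆A∙S σ σ∈ = ε , A.ε∈ , subst S.Mem (solve 1 (λ a → a ⊜ ⊖ :ε ⊕ a) refl σ) σ∈

    module _ (trivial∩ : ∀ a → A.Mem a → S.Mem a → a ≡ ε) where

      -- The cosets `a S` with `a` in `A` are pairwise disjoint, because `a ⁻¹ ∙ b` lies in `A ∩ S`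
      -- as soon as two of them meet.
      order-product : order A∙S ≡ A.size * S.size
      order-product = ℕₚ.≤-antisym
        (subst (_≤ A.size * S.size) (ℕₚ.*-identityʳ _)
          (double-count (A∙S ∋?_) A.Mem? R? 1 S.size
            (λ g (a , a∈ , m) → card-pos (λ a → A.Mem? a ×-dec R? g a) a (a∈ , m))
            (λ a a∈ → ℕₚ.≤-reflexive (column a a∈))))
        (subst (A.size * S.size ≤_) (ℕₚ.*-identityʳ _)
          (double-count A.Mem? (A∙S ∋?_) (λ a g → R? g a) S.size 1
            (λ a a∈ → ℕₚ.≤-reflexive (sym (column a a∈)))
            (λ g _ → card-unique (λ a → A.Mem? a ×-dec R? g a)
              (λ a b (a∈ , m) (b∈ , n) → ∙-cancelˡ (a ⁻¹) a b (trans (inverseˡ a) (sym (trivial∩ (a ⁻¹ ∙ b)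
                (A.∙∈ (A.⁻¹∈ a∈) b∈) (subst S.Mem
                  (solve 3 (λ a b g → (⊖ a ⊕ g) ⊕ ⊖ (⊖ b ⊕ g) ⊜ ⊖ a ⊕ b) refl a b g)
                  (S.∙∈ m (S.⁻¹∈ n))))))))))
        where
        R? : ∀ g a → Dec (S.Mem (a ⁻¹ ∙ g))
        R? g a = S.Mem? (a ⁻¹ ∙ g)
        column : ∀ a → A.Mem a → card (λ g → (A∙S ∋? g) ×-dec R? g a) ≡ S.size
        column a a∈ = trans (card-cong (λ g → (A∙S ∋? g) ×-dec R? g a) (λ g → S.Mem? (a ⁻¹ ∙ g))
          (λ _ → proj₂) (λ g m → (a , a∈ , m) , m)) (S.coset-size a)

      -- A ≅ A S / S, and normal subgroups between S and A S are grown one generator at a time.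
      exponent⇒prime-power : (∀ g k → S.Mem ((k ∙ g) ⁻¹ ∙ (g ∙ k))) →
        ∀ {p} → Prime p → (∀ a → A.Mem a → pow G a p ≡ ε) → ∃[ k ] (A.size ≡ p ^ k)
      exponent⇒prime-power abelian {p} pr exponent =
        go h S 0 (λ _ σ∈ → σ∈) S⊆A∙S (sym (ℕₚ.*-identityʳ _)) (ℕₚ.m≤n+m h S.size)
        where
        go : ∀ fuel (N : NormalSubgroup) k → S.subgroup ⊆ NormalSubgroup.subgroup N →
             NormalSubgroup.subgroup N ⊆ A∙S → NormalSubgroup.size N ≡ S.size * p ^ k →
             h ≤ NormalSubgroup.size N + fuel → ∃[ k ] (A.size ≡ p ^ k)
        go fuel N k S⊆N N⊆A∙S size≡ bound with any? (λ a → A.Mem? a ×-dec ¬? (NormalSubgroup.Mem? N a))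
        ... | no none = k , ℕₚ.*-cancelˡ-≡ A.size (p ^ k) S.size {{>-nonZero S.size-pos}} (begin
            S.size * A.size  ≡⟨ ℕₚ.*-comm S.size A.size ⟩
            A.size * S.size  ≡⟨ order-product ⟨
            order A∙S        ≡⟨ card-cong (A∙S ∋?_) N.Mem? A∙S⊆N N⊆A∙S ⟩
            N.size           ≡⟨ size≡ ⟩
            S.size * p ^ k   ∎)
          where
          open ≡-Reasoning
          module N = NormalSubgroup N
          A∙S⊆N : ∀ g → Mem′ g → N.Mem g
          A∙S⊆N g (a , a∈ , m) = subst N.Mem (solve 2 (λ a g → a ⊕ (⊖ a ⊕ g) ⊜ g) refl a g)
            (N.∙∈ (decidable-stable (N.Mem? a) (λ a∉ → none (a , a∈ , a∉))) (S⊆N _ m))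
        ... | yes (a , a∈A , a∉N) = next fuel bound
          where
          open ≡-Reasoning
          open +-*-Solver using (_:*_; _:=_)
          module N = NormalSubgroup N
          -- Since `N` contains `S` and `G / S` is abelian, `a` is central modulo `N`.
          open Adjoin N pr a (λ g → S⊆N _ (abelian g a)) (subst N.Mem (sym (exponent a a∈A)) N.ε∈)
            using (adjoin; base⊆adjoin; v∈adjoin; adjoin-least; order-adjoin)
          module N′ = NormalSubgroup adjoin
          grows : suc N.size ≤ N′.size
          grows = card-strict N′.Mem? N.Mem? base⊆adjoin a v∈adjoin a∉N
          next : ∀ fuel → h ≤ N.size + fuel → ∃[ k ] (A.size ≡ p ^ k)
          next zero bound = contradiction (ℕₚ.≤-trans grows (card-≤ N′.Mem?))
            (ℕₚ.≤⇒≯ (subst (h ≤_) (ℕₚ.+-identityʳ N.size) bound))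
          next (suc fuel) bound = go fuel adjoin (suc k) (λ σ σ∈ → base⊆adjoin σ (S⊆N σ σ∈))
            (adjoin-least A∙S N⊆A∙S (A⊆A∙S a a∈A))
            (begin
              N′.size               ≡⟨ order-adjoin a∉N ⟩
              p * N.size            ≡⟨ cong (p *_) size≡ ⟩
              p * (S.size * p ^ k)  ≡⟨ +-*-Solver.solve 3 (λ p s q → p :* (s :* q) := s :* (p :* q)) refl p S.size (p ^ k) ⟩
              S.size * p ^ suc k    ∎)
            (ℕₚ.≤-trans bound (ℕₚ.≤-trans (ℕₚ.≤-reflexive (ℕₚ.+-suc N.size fuel)) (ℕₚ.+-monoˡ-≤ fuel grows)))

-- Groups in which every coset g S with g ∉ S lies in one conjugacy class

module CaminaPair {h} (G : FinGroup h) where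

  open FiniteGroup G
  open Extensions G

  -- The subgroup `A` has two uses: embedded in `G / S` it shows that `s` is a power of `p`, and its
  -- nontrivial elements are elements of order `p` outside `S`.
  module Centrality (S : NormalSubgroup) (A : Subgroup)
    {s : ℕ} (2≤s : 2 ≤ s) (h≡ : h ≡ s * s * s)
    (S-size : NormalSubgroup.size S ≡ s) (A-size : Subgroup.size A ≡ s)
    (abelian : ∀ g k → Quotient.Commute S g k)
    (camina : ∀ g σ → ¬ NormalSubgroup.Mem S g → NormalSubgroup.Mem S σ → ∃[ k ] (k ∙ g ∙ k ⁻¹ ≡ g ∙ σ))
    (trivial∩ : ∀ a → A ∋ a → NormalSubgroup.Mem S a → a ≡ ε)
    {p : ℕ} (pr : Prime p) (exponent : ∀ a → A ∋ a → pow G a p ≡ ε)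
    where

    private
      module S = NormalSubgroup S
      module A = Subgroup A

      instance
        p≢0 : NonZero p
        p≢0 = prime⇒nonZero pr

        s≢0 : NonZero s
        s≢0 = >-nonZero (ℕₚ.≤-trans (s≤s z≤n) 2≤s)

      order-power : ∃[ k ] (A.size ≡ p ^ k)
      order-power = Product.exponent⇒prime-power A S trivial∩ (λ g k → abelian k g) pr exponent

      r : ℕ
      r = proj₁ order-power

      s≡ : s ≡ p ^ r
      s≡ = trans (sym A-size) (proj₂ order-power)

      h≡p^ : h ≡ p ^ (r + r + r)
      h≡p^ = begin
        h                          ≡⟨ h≡ ⟩
        s * s * s                  ≡⟨ cong (λ s → s * s * s) s≡ ⟩
        p ^ r * p ^ r * p ^ r      ≡⟨ cong (_* p ^ r) (ℕₚ.^-distribˡ-+-* p r r) ⟨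
        p ^ (r + r) * p ^ r        ≡⟨ ℕₚ.^-distribˡ-+-* p (r + r) r ⟨
        p ^ (r + r + r)            ∎
        where open ≡-Reasoning

      comm : Fin h → Fin h → Fin h
      comm b g = b ⁻¹ ∙ (g ∙ b ∙ g ⁻¹)

      Commute⇒comm∈ : ∀ N b g → Quotient.Commute N b g → NormalSubgroup.Mem N (comm b g)
      Commute⇒comm∈ N b g c = subst N.Mem
        (solve 2 (λ b g → g ⊕ (⊖ (b ⊕ g) ⊕ (g ⊕ b)) ⊕ ⊖ g ⊜ ⊖ b ⊕ (g ⊕ b ⊕ ⊖ g)) refl b g) (N.conj∈ g c)
        where module N = NormalSubgroup N

      conj≡ : ∀ b g → g ∙ b ∙ g ⁻¹ ≡ b ∙ comm b g
      conj≡ = solve 2 (λ b g → g ⊕ b ⊕ ⊖ g ⊜ b ⊕ (⊖ b ⊕ (g ⊕ b ⊕ ⊖ g))) refl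

      comm∈S : ∀ b g → S.Mem (comm b g)
      comm∈S b g = Commute⇒comm∈ S b g (abelian b g)

      -- If conjugation by `g` multiplies `b` and `c` on the right by the same factor, it fixes
      -- `b ∙ c ⁻¹`.
      comm-≈ : ∀ N b c g → Quotient._≈_ N (comm b g) (comm c g) → Quotient.Commute N g (b ∙ c ⁻¹)
      comm-≈ N b c g e = begin
        g ∙ (b ∙ c ⁻¹)                ≈⟨ ≡⇒≈ (solve 3 (λ g b c → g ⊕ (b ⊕ ⊖ c) ⊜ b ⊕ (⊖ b ⊕ (g ⊕ b ⊕ ⊖ g)) ⊕ g ⊕ ⊖ c) refl g b c) ⟩
        b ∙ comm b g ∙ g ∙ c ⁻¹       ≈⟨ ∙-congʳ (∙-congʳ (∙-congˡ e)) ⟩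
        b ∙ comm c g ∙ g ∙ c ⁻¹       ≈⟨ ≡⇒≈ (solve 3 (λ g b c → b ⊕ (⊖ c ⊕ (g ⊕ c ⊕ ⊖ g)) ⊕ g ⊕ ⊖ c ⊜ b ⊕ ⊖ c ⊕ g) refl g b c) ⟩
        b ∙ c ⁻¹ ∙ g                  ∎
        where
        open Quotient N
        open Relation.Binary.Reasoning.Setoid ≈-setoid

      -- Multiplying b on the right by c⁻¹ maps the elements with a given commutator into the centralizer.
      card-comm≤ : ∀ N (K : Subgroup) g σ →
        card (λ b → (K ∋? b) ×-dec Quotient._≈?_ N (comm b g) σ) ≤
        card (λ b → (K ∋? b) ×-dec Quotient.Commute? N g b)
      card-comm≤ N K g σ = card-bounded (λ b → (K ∋? b) ×-dec (comm b g ≈? σ)) λ c (c∈ , e) →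
        card-inj (λ b → (K ∋? b) ×-dec (comm b g ≈? σ)) (λ b → (K ∋? b) ×-dec Commute? g b) (_∙ c ⁻¹)
          (λ b (b∈ , f) → Subgroup.∙∈ K b∈ (Subgroup.⁻¹∈ K c∈) , comm-≈ N b c g (≈-trans f (≈-sym e)))
          (λ b b′ _ _ → ∙-cancelʳ (c ⁻¹) b b′)
        where open Quotient N

      a₀ : ∃[ a ] (A.Mem a × a ≢ ε)
      a₀ = another A.Mem? (subst (2 ≤_) (sym A-size) 2≤s) ε

      -- The coset of `S` through the chosen element of `A` is contained in one conjugacy class, so
      -- all of it inherits the exponent `p`.
      order-p : ∀ v → S.Mem v → pow G (proj₁ a₀ ∙ v) p ≡ ε
      order-p v v∈ with a₀
      ... | a , a∈ , a≢ε with camina a v (λ a∈S → a≢ε (trivial∩ a a∈ a∈S)) v∈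
      ... | k , e = begin
        pow G (a ∙ v) p            ≡⟨ cong (λ b → pow G b p) e ⟨
        pow G (k ∙ a ∙ k ⁻¹) p     ≡⟨ conj-pow k a p ⟩
        k ∙ pow G a p ∙ k ⁻¹       ≡⟨ cong (λ b → k ∙ b ∙ k ⁻¹) (exponent a a∈) ⟩
        k ∙ ε ∙ k ⁻¹               ≡⟨ solve 1 (λ k → k ⊕ :ε ⊕ ⊖ k ⊜ :ε) refl k ⟩
        ε                          ∎
        where open ≡-Reasoning

      module _ (N : NormalSubgroup) where
        open Quotient N
        open NormalSubgroup N

        pow-central : ∀ a v → CentralMod v → ∀ n → pow G (a ∙ v) n ≈ pow G a n ∙ pow G v n
        pow-central a v c zero = ≡⇒≈ (sym (identityˡ ε))
        pow-central a v c (suc n) = begin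
          a ∙ v ∙ pow G (a ∙ v) n              ≈⟨ ∙-congˡ (pow-central a v c n) ⟩
          a ∙ v ∙ (pow G a n ∙ pow G v n)      ≈⟨ ≡⇒≈ (solve 4 (λ a v b w → a ⊕ v ⊕ (b ⊕ w) ⊜ a ⊕ (v ⊕ b) ⊕ w) refl a v (pow G a n) (pow G v n)) ⟩
          a ∙ (v ∙ pow G a n) ∙ pow G v n      ≈⟨ ∙-congʳ (∙-congˡ (c (pow G a n))) ⟩
          a ∙ (pow G a n ∙ v) ∙ pow G v n      ≈⟨ ≡⇒≈ (solve 4 (λ a v b w → a ⊕ (b ⊕ v) ⊕ w ⊜ a ⊕ b ⊕ (v ⊕ w)) refl a v (pow G a n) (pow G v n)) ⟩
          a ∙ pow G a n ∙ (v ∙ pow G v n)      ∎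
          where open Relation.Binary.Reasoning.Setoid ≈-setoid

        -- Modulo `N` the identity `order-p` reads `1 = (a v)^p = a^p v^p = v^p`. This makes `v`
        -- eligible for `Adjoin`.
        central-pow∈ : ∀ v → S.Mem v → CentralMod v → Mem (pow G v p)
        central-pow∈ v v∈ c = ≈∈ (begin
          ε                                  ≈⟨ ≡⇒≈ (sym (order-p v v∈)) ⟩
          pow G (a ∙ v) p                    ≈⟨ pow-central a v c p ⟩
          pow G a p ∙ pow G v p              ≈⟨ ≡⇒≈ (cong (_∙ pow G v p) (exponent a (proj₁ (proj₂ a₀)))) ⟩
          ε ∙ pow G v p                      ≈⟨ ≡⇒≈ (identityˡ _) ⟩
          pow G v p                          ∎) ε∈
          where
          a = proj₁ a₀
          open Relation.Binary.Reasoning.Setoid ≈-setoid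

      -- All `s` elements of `b S` are conjugates of `b`, and each arises from at least as many
      -- conjugating elements as the centralizer of `b` has.
      centralizer-size : ∀ b → ¬ S.Mem b → s * card (λ g → b ∙ g ≟ g ∙ b) ≤ h
      centralizer-size b b∉S = subst₂ _≤_
        (cong (_* c) S-size) (trans (ℕₚ.*-identityʳ _) (card-⊤ {h}))
        (double-count S.Mem? (⊤? {h}) R? c 1 row
          (λ g _ → card-unique (λ σ → S.Mem? σ ×-dec R? σ g)
            (λ σ τ (_ , e) (_ , f) → ∙-cancelˡ b σ τ (trans (sym e) f))))
        where
        c = card (λ g → b ∙ g ≟ g ∙ b)
        R? : ∀ σ g → Dec (g ∙ b ∙ g ⁻¹ ≡ b ∙ σ)
        R? σ g = g ∙ b ∙ g ⁻¹ ≟ b ∙ σ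
        row : ∀ σ → S.Mem σ → c ≤ card (λ g → ⊤? g ×-dec R? σ g)
        row σ σ∈ with camina b σ b∉S σ∈
        ... | k , e = card-inj (λ g → b ∙ g ≟ g ∙ b) (λ g → ⊤? g ×-dec R? σ g) (k ∙_)
          (λ g f → tt , trans (conj k g f) e)
          (λ g g′ _ _ → ∙-cancelˡ k g g′)
          where
          conj : ∀ k g → b ∙ g ≡ g ∙ b → k ∙ g ∙ b ∙ (k ∙ g) ⁻¹ ≡ k ∙ b ∙ k ⁻¹
          conj k g f = begin
            k ∙ g ∙ b ∙ (k ∙ g) ⁻¹        ≡⟨ solve 3 (λ k g b → k ⊕ g ⊕ b ⊕ ⊖ (k ⊕ g) ⊜ k ⊕ (g ⊕ b) ⊕ ⊖ g ⊕ ⊖ k) refl k g b ⟩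
            k ∙ (g ∙ b) ∙ g ⁻¹ ∙ k ⁻¹     ≡⟨ cong (λ x → k ∙ x ∙ g ⁻¹ ∙ k ⁻¹) f ⟨
            k ∙ (b ∙ g) ∙ g ⁻¹ ∙ k ⁻¹     ≡⟨ solve 3 (λ k g b → k ⊕ (b ⊕ g) ⊕ ⊖ g ⊕ ⊖ k ⊜ k ⊕ b ⊕ ⊖ k) refl k g b ⟩
            k ∙ b ∙ k ⁻¹                  ∎
            where open ≡-Reasoning

      -- N is chosen such that [S, G] N / N is cyclic of order p, generated by v; counting the pairs in
      -- S × G that commute modulo N, and those in E × G that commute modulo Z, bounds |E| from both sides.
      module Contradiction (N : NormalSubgroup) (N⊆S : NormalSubgroup.subgroup N ⊆ S.subgroup)
        (v : Fin h) (v∈S : S.Mem v) (v∉N : ¬ NormalSubgroup.Mem N v) (v-central : Quotient.CentralMod N v)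
        (cyclic : ∀ u → S.Mem u → ∀ g → ∃ λ (i : Fin p) → Quotient._≈_ N (pow G v (toℕ i)) (comm g u))
        (u₀ : Fin h) (u₀∈S : S.Mem u₀) (u₀-moved : ¬ Quotient.CentralMod N u₀) where

        open NormalSubgroup N
        open Quotient N

        Z : NormalSubgroup
        Z = record
          { subgroup = record
            { Mem = λ u → S.Mem u × CentralMod u
            ; Mem? = λ u → S.Mem? u ×-dec CentralMod? u
            ; ε∈ = S.ε∈ , λ g → ≈-sym (commutes-ε g)
            ; ∙∈ = λ {a} {b} (a∈ , c) (b∈ , d) → S.∙∈ a∈ b∈ ,
                λ g → ≈-sym (commutes-∙ g a b (≈-sym (c g)) (≈-sym (d g)))
            ; ⁻¹∈ = λ {a} (a∈ , c) → S.⁻¹∈ a∈ , λ g → ≈-sym (commutes-⁻¹ g a (≈-sym (c g))) }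
          ; conj∈ = λ g {a} (a∈ , c) → S.conj∈ g a∈ , λ k → begin
              g ∙ a ∙ g ⁻¹ ∙ k      ≈⟨ ∙-congʳ (commutes⇒conj g a (≈-sym (c g))) ⟩
              a ∙ k                 ≈⟨ c k ⟩
              k ∙ a                 ≈⟨ ∙-congˡ (commutes⇒conj g a (≈-sym (c g))) ⟨
              k ∙ (g ∙ a ∙ g ⁻¹)    ∎ }
          where open Relation.Binary.Reasoning.Setoid ≈-setoid

        E : Subgroup
        E = record
          { Mem = λ g → ∀ u → S.Mem u → Commute u g
          ; Mem? = λ g → all? (λ u → S.Mem? u →-dec Commute? u g)
          ; ε∈ = λ u _ → commutes-ε u
          ; ∙∈ = λ {a} {b} c d u u∈ → commutes-∙ u a b (c u u∈) (d u u∈)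
          ; ⁻¹∈ = λ {a} c u u∈ → commutes-⁻¹ u a (c u u∈) }

        module Z = NormalSubgroup Z
        module E = Subgroup E
        module Z/ = Quotient Z

        E-conj : ∀ g b → E.Mem b → E.Mem (g ∙ b ∙ g ⁻¹)
        E-conj g b b∈ u u∈ = begin
          u ∙ (g ∙ b ∙ g ⁻¹)                  ≈⟨ ≡⇒≈ (solve 3 (λ u g b → u ⊕ (g ⊕ b ⊕ ⊖ g) ⊜ g ⊕ ((⊖ g ⊕ u ⊕ ⊖ (⊖ g)) ⊕ b) ⊕ ⊖ g) refl u g b) ⟩
          g ∙ (g ⁻¹ ∙ u ∙ g ⁻¹ ⁻¹ ∙ b) ∙ g ⁻¹ ≈⟨ conj-cong g (b∈ _ (S.conj∈ (g ⁻¹) u∈)) ⟩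
          g ∙ (b ∙ (g ⁻¹ ∙ u ∙ g ⁻¹ ⁻¹)) ∙ g ⁻¹ ≈⟨ ≡⇒≈ (solve 3 (λ u g b → g ⊕ (b ⊕ (⊖ g ⊕ u ⊕ ⊖ (⊖ g))) ⊕ ⊖ g ⊜ g ⊕ b ⊕ ⊖ g ⊕ u) refl u g b) ⟩
          g ∙ b ∙ g ⁻¹ ∙ u                    ∎
          where open Relation.Binary.Reasoning.Setoid ≈-setoid

        -- Conjugation by `g` multiplies `b` and `c` by commutators in `S`, which commute with `E`
        -- modulo `N`. As `E` is normal, these commutators lie in `E` too and commute with each
        -- other, so `conj-commutator` applies.
        [E,E]⊆Z : ∀ b c → E.Mem b → E.Mem c → Z/.Commute b c
        [E,E]⊆Z b c b∈ c∈ = abelian b c , λ g → ≈-sym (conj⇒commutes g _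
          (conj-commutator g c b (comm c g) (comm b g) (≡⇒≈ (conj≡ c g)) (≡⇒≈ (conj≡ b g))
            (with-S c c∈ c) (with-S c c∈ b) (with-S b b∈ c) (with-S b b∈ b)
            (≈-sym (E.∙∈ (E.⁻¹∈ c∈) (E-conj g c c∈) (comm b g) (comm∈S b g)))))
          where
          with-S : ∀ x → E.Mem x → ∀ y {g} → Commute x (comm y g)
          with-S x x∈ y {g} = ≈-sym (x∈ (comm y g) (comm∈S y g))

        z e : ℕ
        z = Z.size
        e = E.size

        z<s : z < s
        z<s = subst (z <_) S-size (card-strict S.Mem? Z.Mem? (λ _ → proj₁) u₀ u₀∈S (u₀-moved ∘ proj₂))

        2≤z : 2 ≤ z
        2≤z = card-two Z.Mem? ε v Z.ε∈ (v∈S , v-central) (λ v≡ε → v∉N (subst Mem (sym v≡ε) ε∈))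

        -- Modulo `N` the commutator of `g` with `u` takes at most `p` values, each for at most as
        -- many `g` as the centralizer of `u` has.
        index≤p : ∀ u → S.Mem u → h ≤ p * order (centralizer u)
        index≤p u u∈ = subst₂ _≤_ (trans (ℕₚ.*-identityʳ _) (card-⊤ {h})) (cong (_* order (centralizer u)) (card-⊤ {p}))
          (double-count (⊤? {h}) (⊤? {p}) R? 1 (order (centralizer u))
            (λ g _ → let i , f = cyclic u u∈ g in card-pos (λ i → ⊤? i ×-dec R? g i) i (tt , ≈-sym f))
            (λ i _ → ℕₚ.≤-trans (card-comm≤ N whole u (pow G v (toℕ i)))
              (card-mono (λ g → ⊤? g ×-dec Commute? u g) (Commute? u) (λ _ → proj₂))))
          where
          R? : ∀ g (i : Fin p) → Dec (comm g u ≈ pow G v (toℕ i))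
          R? g i = comm g u ≈? pow G v (toℕ i)

        -- Pairs in `S × G` commuting modulo `N`, counted `p` times. An element of `S` commutes with
        -- at least `h / p` elements, one of `Z` with all `h`. An element outside `E` centralizes a
        -- proper subgroup of `S`, hence at most `s / p` elements, one of `E` all `s`. The terms
        -- `s * h` cancel and `p - 1` is divided out.
        z*h≤e*s : z * h ≤ e * s
        z*h≤e*s = ℕₚ.*-cancelʳ-≤ (z * h) (e * s) (pred p) {{pred≢0}} (ℕₚ.+-cancelˡ-≤ (s * h) _ _ (begin
            s * h + z * h * pred p              ≡⟨ cong₂ _+_ (cong (_* h) (sym S-size)) (ℕₚ.*-assoc z h (pred p)) ⟩
            S.size * h + z * (h * pred p)       ≤⟨ weighted-double-count S.Mem? Z.Mem? (⊤? {h}) E.Mem? Commute? p h (h * pred p) s (s * pred p)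
                                                       (λ _ → proj₁) rows rows₁ cols cols₁ ⟩
            card (⊤? {h}) * s + e * (s * pred p) ≡⟨ cong₂ _+_ (trans (cong (_* s) (card-⊤ {h})) (ℕₚ.*-comm h s)) (sym (ℕₚ.*-assoc e s (pred p))) ⟩
            s * h + e * s * pred p              ∎))
          where
          open ≤-Reasoning
          pred≢0 : NonZero (pred p)
          pred≢0 = >-nonZero (s≤s⁻¹ (subst (2 ≤_) (sym (ℕₚ.suc-pred p)) (nonTrivial⇒n>1 p {{prime⇒nonTrivial pr}})))
          m+m*pred : ∀ m → m + m * pred p ≡ p * m
          m+m*pred m = trans (sym (ℕₚ.*-suc m (pred p))) (trans (cong (m *_) (ℕₚ.suc-pred p)) (ℕₚ.*-comm m p))
          rows : ∀ u → S.Mem u → h ≤ p * card (λ g → ⊤? g ×-dec Commute? u g)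
          rows u u∈ = ℕₚ.≤-trans (index≤p u u∈) (ℕₚ.*-monoʳ-≤ p
            (card-mono (Commute? u) (λ g → ⊤? g ×-dec Commute? u g) (λ _ c → tt , c)))
          rows₁ : ∀ u → Z.Mem u → h + h * pred p ≤ p * card (λ g → ⊤? g ×-dec Commute? u g)
          rows₁ u (_ , c) = ℕₚ.≤-trans (ℕₚ.≤-reflexive (m+m*pred h)) (ℕₚ.*-monoʳ-≤ p
            (subst (_≤ card (λ g → ⊤? g ×-dec Commute? u g)) (card-⊤ {h})
              (card-mono ⊤? (λ g → ⊤? g ×-dec Commute? u g) (λ g _ → tt , c g))))
          centralizerS : Fin h → Subgroup
          centralizerS g = record
            { Mem = λ u → S.Mem u × Commute u g ; Mem? = λ u → S.Mem? u ×-dec Commute? u g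
            ; ε∈ = S.ε∈ , ≈-sym (commutes-ε g)
            ; ∙∈ = λ {a} {b} (a∈ , c) (b∈ , d) → S.∙∈ a∈ b∈ , ≈-sym (commutes-∙ g a b (≈-sym c) (≈-sym d))
            ; ⁻¹∈ = λ {a} (a∈ , c) → S.⁻¹∈ a∈ , ≈-sym (commutes-⁻¹ g a (≈-sym c)) }
          cols : ∀ g → ⊤ → ¬ E.Mem g → p * order (centralizerS g) ≤ s
          cols g _ g∉E with any? (λ u → S.Mem? u ×-dec ¬? (Commute? u g))
          ... | no none = contradiction (λ u u∈ → decidable-stable (Commute? u g) (λ ¬c → none (u , u∈ , ¬c))) g∉E
          ... | yes (u , u∈ , ¬c) = subst (p * order (centralizerS g) ≤_) S-size
            (proper-subgroup-≤ pr (centralizerS g) S.subgroup (λ _ → proj₁) r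
              (subst (_∣ p ^ r) (sym (trans S-size s≡)) ∣-refl) u u∈ (¬c ∘ proj₂))
          cols₁ : ∀ g → ⊤ → E.Mem g → p * order (centralizerS g) ≤ s + s * pred p
          cols₁ g _ _ = ℕₚ.≤-trans (ℕₚ.*-monoʳ-≤ p (subst (order (centralizerS g) ≤_) S-size
            (card-mono (centralizerS g ∋?_) S.Mem? (λ _ → proj₁)))) (ℕₚ.≤-reflexive (sym (m+m*pred s)))

        -- Pairs in `G × E` commuting modulo `Z`, counted `s` times. For fixed `g` the commutators
        -- with `E` lie in `S`, in at most `s / z` cosets of `Z`, so `g` commutes with at least
        -- `e z / s` elements of `E`, and with all of `E` if `g` is in `E`. For `b` outside `S` each
        -- of the `z` commutator values in `Z` occurs at most `h / s` times. The terms `h * (e * z)`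
        -- cancel and `s ∸ z` is divided out.
        e*e≤s*h : e * e ≤ s * h
        e*e≤s*h = ℕₚ.*-cancelʳ-≤ (e * e) (s * h) (s ∸ z) {{>-nonZero (ℕₚ.m<n⇒0<n∸m z<s)}}
            (ℕₚ.+-cancelˡ-≤ (h * (e * z)) _ _ (begin
            h * (e * z) + e * e * (s ∸ z)                  ≡⟨ cong₂ _+_ (cong (_* (e * z)) (sym (card-⊤ {h}))) (ℕₚ.*-assoc e e (s ∸ z)) ⟩
            card (⊤? {h}) * (e * z) + e * (e * (s ∸ z))    ≤⟨ weighted-double-count (⊤? {h}) E.Mem? E.Mem? S.Mem? Z/.Commute? s
                                                                (e * z) (e * (s ∸ z)) (h * z) (h * (s ∸ z)) (λ _ _ → tt) rows rows₁ cols cols₁ ⟩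
            e * (h * z) + S.size * (h * (s ∸ z))           ≡⟨ cong₂ _+_ (+-*-Solver.solve 3 (λ e h z → e :* (h :* z) := h :* (e :* z)) refl e h z)
                                                                (trans (cong (_* (h * (s ∸ z))) S-size) (sym (ℕₚ.*-assoc s h (s ∸ z)))) ⟩
            h * (e * z) + s * h * (s ∸ z)                  ∎))
          where
          open ≤-Reasoning
          open +-*-Solver using (_:*_; _:=_)
          m*z+m*[s∸z] : ∀ m → m * z + m * (s ∸ z) ≡ s * m
          m*z+m*[s∸z] m = trans (sym (ℕₚ.*-distribˡ-+ m z (s ∸ z))) (trans (cong (m *_) (ℕₚ.m+[n∸m]≡n (ℕₚ.<⇒≤ z<s))) (ℕₚ.*-comm m s))
          E∩C? : ∀ g b → Dec (E.Mem b × Z/.Commute g b)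
          E∩C? g b = E.Mem? b ×-dec Z/.Commute? g b
          rows : ∀ g → ⊤ → e * z ≤ s * card (E∩C? g)
          rows g _ = subst (λ t → e * z ≤ t * card (E∩C? g)) S-size
            (double-count E.Mem? S.Mem? (λ b σ → comm b g Z/.≈? σ) z (card (E∩C? g))
              (λ b _ → subst (_≤ card (λ σ → S.Mem? σ ×-dec (comm b g Z/.≈? σ))) (Z.coset-size (comm b g))
                (card-mono (λ σ → comm b g Z/.≈? σ) (λ σ → S.Mem? σ ×-dec (comm b g Z/.≈? σ))
                  (λ σ f → subst S.Mem (solve 2 (λ a b → a ⊕ (⊖ a ⊕ b) ⊜ b) refl (comm b g) σ)
                    (S.∙∈ (comm∈S b g) (proj₁ f)) , f)))
              (λ σ _ → card-comm≤ Z E g σ))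
          rows₁ : ∀ g → E.Mem g → e * z + e * (s ∸ z) ≤ s * card (E∩C? g)
          rows₁ g g∈ = ℕₚ.≤-trans (ℕₚ.≤-reflexive (m*z+m*[s∸z] e)) (ℕₚ.*-monoʳ-≤ s
            (card-mono E.Mem? (E∩C? g) (λ b b∈ → b∈ , [E,E]⊆Z g b g∈ b∈)))
          cols : ∀ b → E.Mem b → ¬ S.Mem b → s * card (λ g → ⊤? g ×-dec Z/.Commute? g b) ≤ h * z
          cols b _ b∉S = begin
            s * card (λ g → ⊤? g ×-dec Z/.Commute? g b)   ≤⟨ ℕₚ.*-monoʳ-≤ s (subst (_≤ z * c) (ℕₚ.*-identityʳ _)
                                                               (double-count (λ g → ⊤? g ×-dec Z/.Commute? g b) Z.Mem? R? 1 c row col)) ⟩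
            s * (z * c)                                   ≡⟨ +-*-Solver.solve 3 (λ s z c → s :* (z :* c) := z :* (s :* c)) refl s z c ⟩
            z * (s * c)                                   ≤⟨ ℕₚ.*-monoʳ-≤ z (centralizer-size b b∉S) ⟩
            z * h                                         ≡⟨ ℕₚ.*-comm z h ⟩
            h * z                                         ∎
            where
            c = card (λ g → b ∙ g ≟ g ∙ b)
            R? : ∀ g σ → Dec (comm b g ≡ σ)
            R? g σ = comm b g ≟ σ
            row : ∀ g → ⊤ × Z/.Commute g b → 1 ≤ card (λ σ → Z.Mem? σ ×-dec R? g σ)
            row g (_ , f) = card-pos (λ σ → Z.Mem? σ ×-dec R? g σ) (comm b g)
              (Commute⇒comm∈ Z b g (Z/.≈-sym f) , refl)
            col : ∀ σ → Z.Mem σ → card (λ g → (⊤? g ×-dec Z/.Commute? g b) ×-dec R? g σ) ≤ c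
            col σ _ = card-bounded (λ g → (⊤? g ×-dec Z/.Commute? g b) ×-dec R? g σ) λ k (_ , f) →
              card-inj (λ g → (⊤? g ×-dec Z/.Commute? g b) ×-dec R? g σ) (λ g → b ∙ g ≟ g ∙ b) (k ⁻¹ ∙_)
                (λ g (_ , f′) → shift g k (trans f′ (sym f)))
                (λ g g′ _ _ → ∙-cancelˡ (k ⁻¹) g g′)
              where
              shift : ∀ g k → comm b g ≡ comm b k → b ∙ (k ⁻¹ ∙ g) ≡ k ⁻¹ ∙ g ∙ b
              shift g k f = trans
                (solve 3 (λ b k g → b ⊕ (⊖ k ⊕ g) ⊜ ⊖ k ⊕ b ⊕ (⊖ b ⊕ (k ⊕ b ⊕ ⊖ k)) ⊕ g) refl b k g)
                (trans (cong (λ x → k ⁻¹ ∙ b ∙ x ∙ g) (sym f))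
                (solve 3 (λ b k g → ⊖ k ⊕ b ⊕ (⊖ b ⊕ (g ⊕ b ⊕ ⊖ g)) ⊕ g ⊜ ⊖ k ⊕ g ⊕ b) refl b k g))
          cols₁ : ∀ b → E.Mem b → S.Mem b → s * card (λ g → ⊤? g ×-dec Z/.Commute? g b) ≤ h * z + h * (s ∸ z)
          cols₁ b _ _ = ℕₚ.≤-trans (ℕₚ.*-monoʳ-≤ s (card-≤ (λ g → ⊤? g ×-dec Z/.Commute? g b)))
            (ℕₚ.≤-reflexive (sym (m*z+m*[s∸z] h)))

        absurd : ⊥
        absurd = contradiction z≤1 (ℕₚ.<⇒≱ 2≤z)
          where
          open ≤-Reasoning
          open +-*-Solver using (_:*_; _:=_)
          instance
            s²≢0 : NonZero (s * s)
            s²≢0 = ℕₚ.m*n≢0 s s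
          e≤s² : e ≤ s * s
          e≤s² = square-cancel-≤ (begin
            e * e              ≤⟨ e*e≤s*h ⟩
            s * h              ≡⟨ cong (s *_) h≡ ⟩
            s * (s * s * s)    ≡⟨ +-*-Solver.solve 1 (λ s → s :* (s :* s :* s) := s :* s :* (s :* s)) refl s ⟩
            s * s * (s * s)    ∎)
          z≤1 : z ≤ 1
          z≤1 = ℕₚ.*-cancelʳ-≤ z 1 (s * s * s) {{ℕₚ.m*n≢0 (s * s) s}} (begin
            z * (s * s * s)    ≡⟨ cong (z *_) h≡ ⟨
            z * h              ≤⟨ z*h≤e*s ⟩
            e * s              ≤⟨ ℕₚ.*-monoˡ-≤ s e≤s² ⟩
            s * s * s          ≡⟨ ℕₚ.*-identityˡ _ ⟨
            1 * (s * s * s)    ∎)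

      Moved : NormalSubgroup → Set
      Moved N = ∃[ u ] (S.Mem u × ¬ Quotient.CentralMod N u)

      moved? : ∀ N → Dec (Moved N)
      moved? N = any? (λ u → S.Mem? u ×-dec ¬? (Quotient.CentralMod? N u))

      -- Enlarge N inside S as long as S / N is not central in G / N.
      grow : ∀ fuel (N : NormalSubgroup) → NormalSubgroup.subgroup N ⊆ S.subgroup →
             h ≤ NormalSubgroup.size N + fuel → ¬ Moved N
      grow fuel N N⊆S bound (u , u∈ , moved) = next fuel bound
        where
        open Quotient N
        module N = NormalSubgroup N
        fixed : ∃[ v ] (S.Mem v × ¬ N.Mem v × CentralMod v)
        -- An element of `N` is central modulo `N`, so the moved `u` shows that `S / N` is
        -- nontrivial.
        fixed = ∃-central pr {r + r + r} h≡p^ S N⊆S u u∈ λ u∈N → moved λ g →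
          ≈-trans (∙-congʳ (∈⇒≈ε u∈N)) (≈-trans (≈-sym (commutes-ε g)) (∙-congˡ (≈-sym (∈⇒≈ε u∈N))))
        v = proj₁ fixed
        v∈S = proj₁ (proj₂ fixed)
        v∉N = proj₁ (proj₂ (proj₂ fixed))
        v-central = proj₂ (proj₂ (proj₂ fixed))
        open Adjoin N pr v v-central (central-pow∈ N v v∈S v-central)
        module N′ = NormalSubgroup adjoin
        grows : N.size < N′.size
        grows = card-strict N′.Mem? N.Mem? base⊆adjoin v v∈adjoin v∉N
        next : ∀ fuel → h ≤ N.size + fuel → ⊥
        next fuel bound with moved? adjoin
        -- If `S` is central modulo the enlarged group, all commutators with `S` lie in it, and
        -- membership there is literally the exponent that `cyclic` asks for.
        ... | no none = Contradiction.absurd N N⊆S v v∈S v∉N v-central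
          (λ w w∈ g → Commute⇒comm∈ adjoin g w (Quotient.≈-sym adjoin
            (decidable-stable (Quotient.CentralMod? adjoin w) (λ ¬c → none (w , w∈ , ¬c)) g)))
          u u∈ moved
        next zero bound | yes _ = contradiction (ℕₚ.≤-trans grows (card-≤ N′.Mem?))
          (ℕₚ.≤⇒≯ (subst (h ≤_) (ℕₚ.+-identityʳ N.size) bound))
        next (suc fuel) bound | yes moved′ = grow fuel adjoin (adjoin-least S.subgroup N⊆S v∈S)
          (ℕₚ.≤-trans bound (ℕₚ.≤-trans (ℕₚ.≤-reflexive (ℕₚ.+-suc N.size fuel)) (ℕₚ.+-monoˡ-≤ fuel grows))) moved′

    central : ∀ σ → S.Mem σ → ∀ g → σ ∙ g ≡ g ∙ σ
    central σ σ∈ g with σ ∙ g ≟ g ∙ σ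
    ... | yes c = c
    ... | no ¬c = ⊥-elim (grow h trivial (λ { _ refl → S.ε∈ }) (ℕₚ.m≤n+m h _) (σ , σ∈ , λ c → ¬c (begin
        σ ∙ g                               ≡⟨ solve 2 (λ a b → a ⊜ b ⊕ ⊖ (⊖ a ⊕ b)) refl (σ ∙ g) (g ∙ σ) ⟩
        g ∙ σ ∙ ((σ ∙ g) ⁻¹ ∙ (g ∙ σ)) ⁻¹   ≡⟨ cong (λ x → g ∙ σ ∙ x ⁻¹) (c g) ⟩
        g ∙ σ ∙ ε ⁻¹                        ≡⟨ solve 1 (λ a → a ⊕ ⊖ :ε ⊜ a) refl (g ∙ σ) ⟩
        g ∙ σ                               ∎)))
      where open ≡-Reasoning

-- A partial difference set E meeting every coset of S once forces g S to be one conjugacy class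

odd-product : ∀ {m n} → ¬ 2 ∣ m → ¬ 2 ∣ n → ¬ 2 ∣ m * n
odd-product {m} {n} m-odd n-odd 2∣mn with euclidsLemma m n prime[2] 2∣mn
... | inj₁ 2∣m = m-odd 2∣m
... | inj₂ 2∣n = n-odd 2∣n

module Transversal {h} (G : FinGroup h) where

  open FiniteGroup G

  module _ (S : NormalSubgroup) {E : Pred (Fin h) 0ℓ} (E? : Decidable E) {s : ℕ}
    (s-odd : ¬ 2 ∣ s) (h-odd : ¬ 2 ∣ h)
    (abelian : ∀ g k → Quotient.Commute S g k)
    (E-unique : ∀ e f → E e → E f → NormalSubgroup.Mem S (e ⁻¹ ∙ f) → e ≡ f)
    (E-square : ∀ e → E e → E (e ∙ e))
    (E-products : ∀ g → ¬ NormalSubgroup.Mem S g → card (λ e → E? e ×-dec E? (e ⁻¹ ∙ g)) ≡ s)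
    where

    private
      module S = NormalSubgroup S
      module S/ = Quotient S

    open Quotient trivial using (Conj; Conj?; class-equation; centralizer; Conj-sym; Conj-trans)

    private
      -- Conjugacy in `G` is borrowed from the quotient by the trivial subgroup, where congruence
      -- means `w ⁻¹ ∙ c ≡ ε`.
      Conj⇒≡ : ∀ {u w} → Conj u w → ∃[ k ] (w ≡ k ∙ u ∙ k ⁻¹)
      Conj⇒≡ {u} {w} (k , f) = k , (begin
        w                                            ≡⟨ solve 2 (λ w c → w ⊜ c ⊕ ⊖ (⊖ w ⊕ c)) refl w (k ∙ u ∙ k ⁻¹) ⟩
        k ∙ u ∙ k ⁻¹ ∙ (w ⁻¹ ∙ (k ∙ u ∙ k ⁻¹)) ⁻¹    ≡⟨ cong (λ x → k ∙ u ∙ k ⁻¹ ∙ x ⁻¹) f ⟩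
        k ∙ u ∙ k ⁻¹ ∙ ε ⁻¹                          ≡⟨ solve 1 (λ a → a ⊕ ⊖ :ε ⊜ a) refl (k ∙ u ∙ k ⁻¹) ⟩
        k ∙ u ∙ k ⁻¹                                 ∎)
        where open ≡-Reasoning

      Conj-mod-S : ∀ {u w} → Conj u w → w S/.≈ u
      Conj-mod-S {u} c with Conj⇒≡ c
      ... | k , refl = S/.commutes⇒conj k u (abelian k u)

      class-odd : ∀ g → ¬ 2 ∣ card (Conj? g)
      class-odd g 2∣ = h-odd (subst (2 ∣_)
        (trans (class-equation g) (trans (cong (h *_) (card-≟ ε)) (ℕₚ.*-identityʳ h)))
        (∣m⇒∣m*n (order (centralizer g)) 2∣))

    -- (e , f) ↦ (f , e) acts on the pairs in E × E whose product is conjugate to g; their number is odd.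
    ∃-square : ∀ g → ¬ S.Mem g → ∃[ e ] (E e × Conj g (e ∙ e))
    ∃-square g g∉S with any? (λ e → E? e ×-dec Conj? g (e ∙ e))
    ... | yes e = e
    ... | no none = contradiction (subst (2 ∣_) total (symmetric-sum-even f f-sym f-diag))
                      (odd-product (class-odd g) s-odd)
      where
      P? : ∀ i j → Dec ((E i × E j) × Conj g (i ∙ j))
      P? i j = (E? i ×-dec E? j) ×-dec Conj? g (i ∙ j)
      f : Fin h → Fin h → ℕ
      f i j = ind (P? i j)
      -- The class is preserved because `j ∙ i` is the conjugate of `i ∙ j` by `j`.
      swap : ∀ i j → (E i × E j) × Conj g (i ∙ j) → (E j × E i) × Conj g (j ∙ i)
      swap i j ((ei , ej) , c) = (ej , ei) , Conj-trans c
        (j , subst (λ x → (j ∙ i) ⁻¹ ∙ x ≡ ε) (solve 2 (λ i j → j ⊕ i ⊜ j ⊕ (i ⊕ j) ⊕ ⊖ j) refl i j) (inverseˡ (j ∙ i)))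
      f-sym : ∀ i j → f i j ≡ f j i
      f-sym i j = ℕₚ.≤-antisym (ind-mono (P? i j) (P? j i) (swap i j)) (ind-mono (P? j i) (P? i j) (swap j i))
      f-diag : ∀ i → f i i ≡ 0
      f-diag i = ind-no (P? i i) (λ ((e , _) , c) → none (i , e , c))
      -- Change of variable from the factor `j` to the product `c = i ∙ j`: every `c` in the class
      -- lies outside `S`, so it has exactly `s` factorizations.
      Q? : ∀ i c → Dec (Conj g c × (E i × E (i ⁻¹ ∙ c)))
      Q? i c = Conj? g c ×-dec (E? i ×-dec E? (i ⁻¹ ∙ c))
      column : ∀ c → sum (λ i → ind (Q? i c)) ≡ ind (Conj? g c) * s
      column c = trans (sym (card≡sum (λ i → Q? i c))) (count (Conj? g c))
        where
        count : (d : Dec (Conj g c)) → card (λ i → Q? i c) ≡ ind d * s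
        count (no ¬c)  = card-≡0 (λ i → Q? i c) (λ i (c , _) → ¬c c)
        count (yes gc) = trans (card-cong (λ i → Q? i c) (λ i → E? i ×-dec E? (i ⁻¹ ∙ c)) (λ _ → proj₂) (λ _ e → gc , e))
          (trans (E-products c (λ c∈ → g∉S (S/.≈∈ (Conj-mod-S gc) c∈))) (sym (ℕₚ.+-identityʳ s)))
      total : sum (λ i → sum (f i)) ≡ card (Conj? g) * s
      total = begin
        sum (λ i → sum (λ j → ind (P? i j)))
          ≡⟨ sum-cong-≗ (λ i → trans (sym (card≡sum (P? i))) (trans (row i) (card≡sum (Q? i)))) ⟩
        sum (λ i → sum (λ c → ind (Q? i c)))
          ≡⟨ ∑-comm (λ i c → ind (Q? i c)) ⟩
        sum (λ c → sum (λ i → ind (Q? i c)))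
          ≡⟨ sum-cong-≗ column ⟩
        sum (λ c → ind (Conj? g c) * s)
          ≡⟨ *-distribʳ-sum s (λ c → ind (Conj? g c)) ⟨
        sum (λ c → ind (Conj? g c)) * s
          ≡⟨ cong (_* s) (card≡sum (Conj? g)) ⟨
        card (Conj? g) * s ∎
        where
        open ≡-Reasoning
        row : ∀ i → card (P? i) ≡ card (Q? i)
        row i = ℕₚ.≤-antisym
          (card-inj (P? i) (Q? i) (i ∙_)
            (λ j ((ei , ej) , c) → c , ei , subst E (solve 2 (λ i j → j ⊜ ⊖ i ⊕ (i ⊕ j)) refl i j) ej)
            (λ j k _ _ → ∙-cancelˡ i j k))
          (card-inj (Q? i) (P? i) (i ⁻¹ ∙_)
            (λ c (gc , ei , ej) → (ei , ej) , subst (Conj g) (solve 2 (λ i c → c ⊜ i ⊕ (⊖ i ⊕ c)) refl i c) gc)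
            (λ j k _ _ → ∙-cancelˡ (i ⁻¹) j k))

    coset-conjugate : ∀ g σ → ¬ S.Mem g → S.Mem σ → ∃[ k ] (k ∙ g ∙ k ⁻¹ ≡ g ∙ σ)
    coset-conjugate g σ g∉S σ∈ = k , sym gσ≡
      where
      gσ≈g : g ∙ σ S/.≈ g
      gσ≈g = subst S.Mem (solve 2 (λ g a → ⊖ a ⊜ ⊖ (g ⊕ a) ⊕ g) refl g σ) (S.⁻¹∈ σ∈)
      e f : ∃[ e ] (E e × _)
      e = ∃-square g g∉S
      f = ∃-square (g ∙ σ) (λ gσ∈ → g∉S (S/.≈∈ gσ≈g gσ∈))
      e≡f : proj₁ e ∙ proj₁ e ≡ proj₁ f ∙ proj₁ f
      e≡f = E-unique _ _ (E-square _ (proj₁ (proj₂ e))) (E-square _ (proj₁ (proj₂ f)))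
        (S/.≈-trans (Conj-mod-S (proj₂ (proj₂ e)))
          (S/.≈-trans (S/.≈-sym gσ≈g) (S/.≈-sym (Conj-mod-S (proj₂ (proj₂ f))))))
      conjugate : ∃[ k ] (g ∙ σ ≡ k ∙ g ∙ k ⁻¹)
      conjugate = Conj⇒≡ (Conj-trans (proj₂ (proj₂ e)) (subst (λ x → Conj x (g ∙ σ)) (sym e≡f) (Conj-sym (proj₂ (proj₂ f)))))
      k = proj₁ conjugate
      gσ≡ = proj₂ conjugate

-- Generalized quadrangles of order (s , s)

module Quadrangle {np nl s} (𝒮 : Incidence np nl) (gq : IsGQ 𝒮 s s) (2≤s : 2 ≤ s) where

  open IsGQ gq

  infix 4 _∈_ _∈?_ _∼_ _∼?_

  _∈_ : Fin np → Fin nl → Set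
  _∈_ = I 𝒮

  _∈?_ : ∀ p L → Dec (p ∈ L)
  _∈?_ = I? 𝒮

  _∼_ : Fin np → Fin np → Set
  _∼_ = Collinear 𝒮

  _∼?_ : ∀ p q → Dec (p ∼ q)
  p ∼? q = any? (λ L → (p ∈? L) ×-dec (q ∈? L))

  ∼-sym : ∀ {p q} → p ∼ q → q ∼ p
  ∼-sym (L , p∈L , q∈L) = L , q∈L , p∈L

  private
    1≤1+s : 1 ≤ suc s
    1≤1+s = s≤s z≤n

    2≤1+s : 2 ≤ suc s
    2≤1+s = ℕₚ.m≤n⇒m≤1+n 2≤s

  line-through : ∀ p → ∃[ L ] (p ∈ L)
  line-through p = card-positive⇒∃ (p ∈?_) (subst (1 ≤_) (sym (pointDegree p)) 1≤1+s)

  another-line : ∀ p L → ∃[ M ] (p ∈ M × M ≢ L)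
  another-line p = another (p ∈?_) (subst (2 ≤_) (sym (pointDegree p)) 2≤1+s)

  another-point : ∀ L p → ∃[ q ] (q ∈ L × q ≢ p)
  another-point L = another (_∈? L) (subst (2 ≤_) (sym (lineSize L)) 2≤1+s)

  project : ∀ p L → ¬ p ∈ L → ∃[ q ] (q ∈ L × p ∼ q)
  project p L p∉L = let q , r , _ = gqAxiom p L p∉L in q , r

  project-unique : ∀ {p L q r} → ¬ p ∈ L → q ∈ L → p ∼ q → r ∈ L → p ∼ r → q ≡ r
  project-unique {p} {L} p∉L q∈L p∼q r∈L p∼r =
    let _ , _ , unique = gqAxiom p L p∉L in trans (sym (unique (q∈L , p∼q))) (unique (r∈L , p∼r))

  no-triangle : ∀ {p L q r} → q ∈ L → r ∈ L → q ≢ r → p ∼ q → p ∼ r → p ∈ L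
  no-triangle {p} {L} q∈L r∈L q≢r p∼q p∼r =
    decidable-stable (p ∈? L) (λ p∉L → q≢r (project-unique p∉L q∈L p∼q r∈L p∼r))

  other-lines : ∀ r X → r ∈ X → card (λ L → (r ∈? L) ×-dec ¬? (L ≟ X)) ≡ s
  other-lines r X r∈X = ℕₚ.suc-injective (trans (sym (card-remove (r ∈?_) X r∈X)) (pointDegree r))

  other-points : ∀ L q → q ∈ L → card (λ p → (p ∈? L) ×-dec ¬? (p ≟ q)) ≡ s
  other-points L q q∈L = ℕₚ.suc-injective (trans (sym (card-remove (_∈? L) q q∈L)) (lineSize L))

  -- Each line on `y` carries exactly one of them, the projection of `x`.
  common-neighbours : ∀ {x y} → ¬ x ∼ y → card (λ r → (x ∼? r) ×-dec (y ∼? r)) ≡ suc s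
  common-neighbours {x} {y} x≁y = trans
    (correspondence (λ r → (x ∼? r) ×-dec (y ∼? r)) (y ∈?_) _∈?_
      (λ r (_ , L , y∈L , r∈L) → L , y∈L , r∈L)
      (λ r L M (x∼r , _) y∈L y∈M r∈L r∈M → partialLinear y r L M (λ { refl → x≁y x∼r }) y∈L r∈L y∈M r∈M)
      (λ L y∈L → let r , r∈L , x∼r = project x L (x∉ y∈L) in r , (x∼r , L , y∈L , r∈L) , r∈L)
      (λ L r r′ y∈L (x∼r , _) (x∼r′ , _) r∈L r′∈L → project-unique (x∉ y∈L) r∈L x∼r r′∈L x∼r′))
    (pointDegree y)
    where
    x∉ : ∀ {L} → y ∈ L → ¬ x ∈ L
    x∉ y∈L x∈L = x≁y (_ , x∈L , y∈L)

  common-neighbours-≁ : ∀ {x y r r′} → ¬ x ∼ y → x ∼ r → y ∼ r → x ∼ r′ → y ∼ r′ → r ≢ r′ → ¬ r ∼ r′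
  common-neighbours-≁ x≁y x∼r y∼r x∼r′ y∼r′ r≢r′ (L , r∈L , r′∈L) =
    x≁y (L , no-triangle r∈L r′∈L r≢r′ x∼r x∼r′ , no-triangle r∈L r′∈L r≢r′ y∼r y∼r′)

  module Affine (x : Fin np) where

    Aff : Pred (Fin np) 0ℓ
    Aff z = ¬ x ∼ z

    Aff? : Decidable Aff
    Aff? z = ¬? (x ∼? z)

    aff∉ : ∀ {z X} → Aff z → x ∈ X → ¬ z ∈ X
    aff∉ a x∈X z∈X = a (_ , x∈X , z∈X)

    aff-line : ∀ {z L} → Aff z → z ∈ L → ¬ x ∈ L
    aff-line a z∈L x∈L = a (_ , x∈L , z∈L)

    aff≢ : ∀ {z r} → Aff z → x ∼ r → z ≢ r
    aff≢ a x∼r refl = a x∼r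

    aff-neighbour≢ : ∀ {z r} → Aff z → z ∼ r → r ≢ x
    aff-neighbour≢ a z∼r refl = a (∼-sym z∼r)

    affine-on : ∀ {L q z} → ¬ x ∈ L → q ∈ L → x ∼ q → z ∈ L → z ≢ q → Aff z
    affine-on x∉L q∈L x∼q z∈L z≢q x∼z = z≢q (project-unique x∉L z∈L x∼z q∈L x∼q)

    affine-points : ∀ L → ¬ x ∈ L → card (λ z → (z ∈? L) ×-dec Aff? z) ≡ s
    affine-points L x∉L = let q , q∈L , x∼q = project x L x∉L in trans
      (card-cong (λ z → (z ∈? L) ×-dec Aff? z) (λ z → (z ∈? L) ×-dec ¬? (z ≟ q))
        (λ z (z∈L , a) → z∈L , aff≢ a x∼q)
        (λ z (z∈L , z≢q) → z∈L , affine-on x∉L q∈L x∼q z∈L z≢q))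
      (other-points L q q∈L)

    other-line-affine : ∀ {r X L} → x ∈ X → r ∈ X → r ≢ x → r ∈ L → L ≢ X → ¬ x ∈ L
    other-line-affine x∈X r∈X r≢x r∈L L≢X x∈L = L≢X (partialLinear _ x _ _ r≢x r∈L x∈L r∈X x∈X)

    affine-neighbours : ∀ r → x ∼ r → r ≢ x → card (λ z → Aff? z ×-dec (z ∼? r)) ≡ s * s
    affine-neighbours r (X , x∈X , r∈X) r≢x = sym (trans (cong (_* s) (sym (other-lines r X r∈X))) (trans
      (double-count-≡ (λ L → (r ∈? L) ×-dec ¬? (L ≟ X)) (λ z → Aff? z ×-dec (z ∼? r)) (λ L z → z ∈? L) s 1
        (λ L (r∈L , L≢X) → trans
          (card-cong (λ z → (Aff? z ×-dec (z ∼? r)) ×-dec (z ∈? L)) (λ z → (z ∈? L) ×-dec Aff? z)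
            (λ z ((a , _) , z∈L) → z∈L , a) (λ z (z∈L , a) → (a , L , z∈L , r∈L) , z∈L))
          (affine-points L (other-line-affine x∈X r∈X r≢x r∈L L≢X)))
        (λ z (a , L , z∈L , r∈L) → ℕₚ.≤-antisym
          (card-unique (λ L → ((r ∈? L) ×-dec ¬? (L ≟ X)) ×-dec (z ∈? L))
            (λ L M ((r∈L , _) , z∈L) ((r∈M , _) , z∈M) →
              partialLinear z r L M (aff≢ a (X , x∈X , r∈X)) z∈L r∈L z∈M r∈M))
          (card-pos (λ L → ((r ∈? L) ×-dec ¬? (L ≟ X)) ×-dec (z ∈? L)) L
            ((r∈L , λ { refl → aff∉ a x∈X z∈L }) , z∈L))))
      (ℕₚ.*-identityʳ _)))

    affine-neighbour : ∀ r → x ∼ r → r ≢ x → ∃[ z ] (Aff z × z ∼ r)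
    affine-neighbour r x∼r r≢x = card-positive⇒∃ (λ z → Aff? z ×-dec (z ∼? r))
      (subst (1 ≤_) (sym (affine-neighbours r x∼r r≢x)) (ℕₚ.≤-trans (s≤s z≤n) (ℕₚ.*-mono-≤ 2≤s 2≤s)))

    -- On a fixed line through `x`, each affine point is collinear with exactly one of the `s`
    -- points other than `x`, and each of these has `s * s` affine neighbours.
    affine-count : card Aff? ≡ s * s * s
    affine-count = let X , x∈X = line-through x in sym (trans
      (trans (ℕₚ.*-assoc s s s) (cong (_* (s * s)) (sym (other-points X x x∈X)))) (trans
      (double-count-≡ (λ r → (r ∈? X) ×-dec ¬? (r ≟ x)) Aff? (λ r z → z ∼? r) (s * s) 1
        (λ r (r∈X , r≢x) → affine-neighbours r (X , x∈X , r∈X) r≢x)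
        (λ z a → let r , r∈X , z∼r = project z X (aff∉ a x∈X) in ℕₚ.≤-antisym
          (card-unique (λ r → ((r ∈? X) ×-dec ¬? (r ≟ x)) ×-dec (z ∼? r))
            (λ r r′ ((r∈X , _) , z∼r) ((r′∈X , _) , z∼r′) → project-unique (aff∉ a x∈X) r∈X z∼r r′∈X z∼r′))
          (card-pos (λ r → ((r ∈? X) ×-dec ¬? (r ≟ x)) ×-dec (z ∼? r)) r
            ((r∈X , aff-neighbour≢ a z∼r) , z∼r))))
      (ℕₚ.*-identityʳ _)))

    module _ {r₁ r₂} (x∼r₁ : x ∼ r₁) (x∼r₂ : x ∼ r₂) (r₁≁r₂ : ¬ r₁ ∼ r₂) where

      private
        r₁≢x : r₁ ≢ x
        r₁≢x refl = r₁≁r₂ x∼r₂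

      -- Project `r₂` to a line on `r₁` that misses `x`. Were the projection collinear with `x`, it
      -- would be `r₁`.
      common-affine-neighbour : ∃[ z ] (Aff z × r₁ ∼ z × r₂ ∼ z)
      common-affine-neighbour =
        let X , x∈X , r₁∈X = x∼r₁
            L , r₁∈L , L≢X = another-line r₁ X
            z , z∈L , r₂∼z = project r₂ L (λ r₂∈L → r₁≁r₂ (L , r₁∈L , r₂∈L))
        in z , (λ x∼z → r₁≁r₂ (∼-sym (subst (r₂ ∼_)
                  (project-unique (other-line-affine x∈X r₁∈X r₁≢x r₁∈L L≢X) z∈L x∼z r₁∈L x∼r₁) r₂∼z)))
             , (L , r₁∈L , z∈L) , r₂∼z

      -- Each of the `s` lines on `r₁` that miss `x` carries at most one, the projection of `r₂`.
      common-affine-neighbours-≤ : card (λ z → Aff? z ×-dec ((r₁ ∼? z) ×-dec (r₂ ∼? z))) ≤ s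
      common-affine-neighbours-≤ = let X , x∈X , r₁∈X = x∼r₁ in
        subst₂ _≤_ (ℕₚ.*-identityʳ _) (trans (ℕₚ.*-identityʳ _) (other-lines r₁ X r₁∈X))
          (double-count (λ z → Aff? z ×-dec ((r₁ ∼? z) ×-dec (r₂ ∼? z)))
            (λ L → (r₁ ∈? L) ×-dec ¬? (L ≟ X)) _∈?_ 1 1
            (λ z (a , (L , r₁∈L , z∈L) , _) → card-pos (λ L → ((r₁ ∈? L) ×-dec ¬? (L ≟ X)) ×-dec (z ∈? L)) L
              ((r₁∈L , λ { refl → aff∉ a x∈X z∈L }) , z∈L))
            (λ L (r₁∈L , _) → card-unique (λ z → (Aff? z ×-dec ((r₁ ∼? z) ×-dec (r₂ ∼? z))) ×-dec (z ∈? L))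
              (λ z w ((_ , _ , r₂∼z) , z∈L) ((_ , _ , r₂∼w) , w∈L) →
                project-unique (λ r₂∈L → r₁≁r₂ (L , r₁∈L , r₂∈L)) z∈L r₂∼z w∈L r₂∼w)))

-- Elation quadrangles of order (s , s) with s symmetries about x

module Elation {np nl h s} (𝒮 : Incidence np nl) (x : Fin np) (G : FinGroup h) (act : AutAction 𝒮 G)
  (gq : IsGQ 𝒮 s s) (2≤s : 2 ≤ s) (egq : IsEGQ 𝒮 G act x) (symmetries : HasSymmetryGroup act x s) where

  open Quadrangle 𝒮 gq 2≤s
  open Affine x
  open IsGQ gq using (partialLinear)
  open IsEGQ egq
  open HasSymmetryGroup symmetries using (symm) renaming (S to Sym; S? to Sym?; size to Sym-size)
  open FiniteGroup G

  infixr 6 _·_ _∗_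

  _·_ : Fin h → Fin np → Fin np
  _·_ = onPt act

  _∗_ : Fin h → Fin nl → Fin nl
  _∗_ = onLn act

  private
    symmetryGroup : Subgroup
    symmetryGroup = record
      { Mem = Sym ; Mem? = Sym? ; ε∈ = HasSymmetryGroup.ε∈S symmetries
      ; ∙∈ = HasSymmetryGroup.∙-closed symmetries _ _ ; ⁻¹∈ = HasSymmetryGroup.⁻¹-closed symmetries _ }

    ·-inverseˡ : ∀ g p → g ⁻¹ · g · p ≡ p
    ·-inverseˡ g p = trans (sym (mulPt act _ _ p)) (trans (cong (_· p) (inverseˡ g)) (idPt act p))

    ·-inverseʳ : ∀ g p → g · g ⁻¹ · p ≡ p
    ·-inverseʳ g p = trans (sym (mulPt act _ _ p)) (trans (cong (_· p) (inverseʳ g)) (idPt act p))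

    ∗-inverseˡ : ∀ g L → g ⁻¹ ∗ g ∗ L ≡ L
    ∗-inverseˡ g L = trans (sym (mulLn act _ _ L)) (trans (cong (_∗ L) (inverseˡ g)) (idLn act L))

    ·-injective : ∀ g {p q} → g · p ≡ g · q → p ≡ q
    ·-injective g {p} {q} e = trans (sym (·-inverseˡ g p)) (trans (cong (g ⁻¹ ·_) e) (·-inverseˡ g q))

    ·-move : ∀ g {p q} → g · p ≡ q → g ⁻¹ · q ≡ p
    ·-move g {p} e = trans (cong (g ⁻¹ ·_) (sym e)) (·-inverseˡ g p)

    ∈-act : ∀ g {p L} → p ∈ L → g · p ∈ g ∗ L
    ∈-act g {p} {L} = Equivalence.to (preserves act g p L)

    ∈-act⁻ : ∀ g {p L} → g · p ∈ g ∗ L → p ∈ L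
    ∈-act⁻ g {p} {L} = Equivalence.from (preserves act g p L)

    ∼-act : ∀ g {p q} → p ∼ q → g · p ∼ g · q
    ∼-act g (L , p∈L , q∈L) = g ∗ L , ∈-act g p∈L , ∈-act g q∈L

  stabilizer : Fin nl → Subgroup
  stabilizer L = record
    { Mem = Stab act L ; Mem? = λ g → g ∗ L ≟ L ; ε∈ = idLn act L
    ; ∙∈ = λ {a} {b} aL bL → trans (mulLn act a b L) (trans (cong (a ∗_) bL) aL)
    ; ⁻¹∈ = λ {a} aL → trans (cong (a ⁻¹ ∗_) (sym aL)) (∗-inverseˡ a L) }

  on-fixed-line : ∀ g {p X} → x ∈ X → p ∈ X → g · p ∈ X
  on-fixed-line g {p} {X} x∈X p∈X = subst (g · p ∈_) (fixesLinesThroughX g X x∈X) (∈-act g p∈X)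

  fixes-x : ∀ g → g · x ≡ x
  fixes-x g =
    let X , x∈X = line-through x
        Y , x∈Y , Y≢X = another-line x X
    in decidable-stable (g · x ≟ x) λ gx≢x → Y≢X (sym
         (partialLinear (g · x) x X Y gx≢x (on-fixed-line g x∈X x∈X) x∈X (on-fixed-line g x∈Y x∈Y) x∈Y))

  ∼x-act : ∀ g {p} → x ∼ p → x ∼ g · p
  ∼x-act g {p} x∼p = subst (_∼ g · p) (fixes-x g) (∼-act g x∼p)

  aff-act : ∀ g {z} → Aff z → Aff (g · z)
  aff-act g {z} a x∼gz = a (subst (x ∼_) (·-inverseˡ g z) (∼x-act (g ⁻¹) x∼gz))

  sharp : ∀ {y z} → Aff y → Aff z → ∃[ g ] (g · y ≡ z)
  sharp a b = let g , e , _ = sharplyTransitive _ _ a b in g , e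

  sharp-unique : ∀ {y g k} → Aff y → g · y ≡ k · y → g ≡ k
  sharp-unique {y} {g} {k} a e = let _ , _ , unique = sharplyTransitive y (k · y) a (aff-act k a) in
    trans (sym (unique e)) (unique refl)

  -- The line joining `x` and `q` is fixed, so `g · q` is the point on it collinear with `g · z`,
  -- and `q` is such a point.
  fixes-neighbour : ∀ g {z q} → Aff z → x ∼ q → z ∼ q → g · z ∼ q → g · q ≡ q
  fixes-neighbour g {z} a (X , x∈X , q∈X) z∼q gz∼q =
    project-unique (aff∉ (aff-act g a) x∈X) (on-fixed-line g x∈X q∈X) (∼-act g z∼q) q∈X gz∼q

  stabilizes : ∀ g {y L} → Aff y → y ∈ L → g · y ∈ L → g ∗ L ≡ L
  stabilizes g {y} {L} a y∈L gy∈L =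
    let q , q∈L , x∼q = project x L (aff-line a y∈L)
        gq≡q = fixes-neighbour g a x∼q (L , y∈L , q∈L) (L , gy∈L , q∈L)
    in partialLinear (g · y) q (g ∗ L) L (aff≢ (aff-act g a) x∼q)
         (∈-act g y∈L) (subst (_∈ g ∗ L) gq≡q (∈-act g q∈L)) gy∈L q∈L

  stab-act : ∀ g {y L} → g ∗ L ≡ L → y ∈ L → g · y ∈ L
  stab-act g {y} gL y∈L = subst (g · y ∈_) gL (∈-act g y∈L)

  order≡ : h ≡ s * s * s
  order≡ =
    let X , x∈X = line-through x
        Y , x∈Y , Y≢X = another-line x X
        r , r∈Y , r≢x = another-point Y x
        y , a , _ = affine-neighbour r (Y , x∈Y , r∈Y) r≢x
    in trans (sym (card-⊤ {h})) (trans
      (correspondence (⊤? {h}) Aff? (λ g z → g · y ≟ z)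
        (λ g _ → g · y , aff-act g a , refl) (λ _ _ _ _ _ _ e f → trans (sym e) f)
        (λ z b → let g , e = sharp a b in g , tt , e) (λ _ _ _ _ _ _ e f → sharp-unique a (trans e (sym f))))
      affine-count)

  stabilizer-size : ∀ L → ¬ x ∈ L → Subgroup.size (stabilizer L) ≡ s
  stabilizer-size L x∉L =
    let q , q∈L , x∼q = project x L x∉L
        y , y∈L , y≢q = another-point L q
        a = affine-on x∉L q∈L x∼q y∈L y≢q
    in trans
      (correspondence (λ g → g ∗ L ≟ L) (λ z → (z ∈? L) ×-dec Aff? z) (λ g z → g · y ≟ z)
        (λ g gL → g · y , (stab-act g gL y∈L , aff-act g a) , refl) (λ _ _ _ _ _ _ e f → trans (sym e) f)
        (λ z (z∈L , b) → let g , e = sharp a b in g , stabilizes g a y∈L (subst (_∈ L) (sym e) z∈L) , e)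
        (λ _ _ _ _ _ _ e f → sharp-unique a (trans e (sym f))))
      (affine-points L x∉L)

  -- The elements fixing r₁ and r₂ act semiregularly on the s affine points collinear with both,
  -- so there are no more of them than symmetries.
  fixes-two⇒symmetry : ∀ {g r₁ r₂} → x ∼ r₁ → x ∼ r₂ → ¬ r₁ ∼ r₂ → g · r₁ ≡ r₁ → g · r₂ ≡ r₂ → Sym g
  fixes-two⇒symmetry {g} {r₁} {r₂} x∼r₁ x∼r₂ r₁≁r₂ e₁ e₂ =
    ⊆∧card-≥⇒⊇ Fix? Sym? (λ σ σ∈ → symm σ σ∈ r₁ x∼r₁ , symm σ σ∈ r₂ x∼r₂)
      (ℕₚ.≤-trans few (ℕₚ.≤-reflexive (sym Sym-size))) g (e₁ , e₂)
    where
    Fix? = λ g → (g · r₁ ≟ r₁) ×-dec (g · r₂ ≟ r₂)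
    few : card Fix? ≤ s
    few = let z , a , r₁∼z , r₂∼z = common-affine-neighbour x∼r₁ x∼r₂ r₁≁r₂ in ℕₚ.≤-trans
      (card-inj Fix? (λ z → Aff? z ×-dec ((r₁ ∼? z) ×-dec (r₂ ∼? z))) (_· z)
        (λ g (e₁ , e₂) → aff-act g a , subst (_∼ g · z) e₁ (∼-act g r₁∼z) , subst (_∼ g · z) e₂ (∼-act g r₂∼z))
        (λ g k _ _ → sharp-unique a))
      (common-affine-neighbours-≤ x∼r₁ x∼r₂ r₁≁r₂)

  -- An elation carrying one affine neighbour of `r` to another fixes `r`; a fixed starting point
  -- leaves `s * s` targets.
  fixer-≥ : ∀ {r} → x ∼ r → r ≢ x → s * s ≤ card (λ g → g · r ≟ r)
  fixer-≥ {r} x∼r r≢x =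
    let y , a , y∼r = affine-neighbour r x∼r r≢x in
    subst (_≤ card (λ g → g · r ≟ r)) (affine-neighbours r x∼r r≢x)
      (subst₂ _≤_ (ℕₚ.*-identityʳ _) (ℕₚ.*-identityʳ _)
        (double-count (λ z → Aff? z ×-dec (z ∼? r)) (λ g → g · r ≟ r) (λ z g → g · y ≟ z) 1 1
          (λ z (b , z∼r) → let g , e = sharp a b in
            card-pos (λ g → (g · r ≟ r) ×-dec (g · y ≟ z)) g
              (fixes-neighbour g a x∼r y∼r (subst (_∼ r) (sym e) z∼r) , e))
          (λ g _ → card-unique (λ z → (Aff? z ×-dec (z ∼? r)) ×-dec (g · y ≟ z))
            (λ _ _ (_ , e) (_ , f) → trans (sym e) f))))

  -- Each of the 1 + s points of {x , y}^⊥ is fixed by s² - s elements that are not symmetries,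
  -- and these sets are disjoint, so they exhaust the s³ - s elements that are not symmetries.
  fixes-some : ∀ {y} → Aff y → ∀ g → ∃[ r ] (x ∼ r × y ∼ r × g · r ≡ r)
  fixes-some {y} a g with Sym? g
  ... | yes g∈ = let r , x∼r , y∼r = card-positive⇒∃ (λ r → (x ∼? r) ×-dec (y ∼? r))
                                       (subst (1 ≤_) (sym (common-neighbours a)) (s≤s z≤n))
                 in r , x∼r , y∼r , symm g g∈ r x∼r
  ... | no g∉ = proj₂ (⊆∧card-≥⇒⊇ (λ g → ¬? (Sym? g)) Q? (λ _ → proj₁) enough g g∉)
    where
    P? = λ r → (x ∼? r) ×-dec (y ∼? r)
    Q? = λ g → ¬? (Sym? g) ×-dec any? (λ r → (x ∼? r) ×-dec ((y ∼? r) ×-dec (g · r ≟ r)))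
    rows : ∀ r → x ∼ r × y ∼ r → s * s ∸ s ≤ card (λ g → Q? g ×-dec (g · r ≟ r))
    rows r (x∼r , y∼r) = begin
      s * s ∸ s                                            ≤⟨ ℕₚ.∸-monoˡ-≤ s (fixer-≥ x∼r (aff-neighbour≢ a y∼r)) ⟩
      card F? ∸ s                                          ≡⟨ cong (_∸ s) (card-split F? Sym?) ⟩
      card (λ g → F? g ×-dec Sym? g) + N ∸ s               ≤⟨ ℕₚ.∸-monoˡ-≤ s (ℕₚ.+-monoˡ-≤ N
                                                                (subst (card (λ g → F? g ×-dec Sym? g) ≤_) Sym-size
                                                                  (card-mono (λ g → F? g ×-dec Sym? g) Sym? (λ _ → proj₂)))) ⟩
      s + N ∸ s                                            ≡⟨ ℕₚ.m+n∸m≡n s N ⟩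
      N                                                    ≤⟨ card-mono (λ g → F? g ×-dec ¬? (Sym? g)) (λ g → Q? g ×-dec F? g)
                                                                (λ g (e , g∉) → (g∉ , r , x∼r , y∼r , e) , e) ⟩
      card (λ g → Q? g ×-dec F? g)                         ∎
      where
      open ≤-Reasoning
      F? = λ g → g · r ≟ r
      N = card (λ g → F? g ×-dec ¬? (Sym? g))
    enough : card (λ g → ¬? (Sym? g)) ≤ card Q?
    enough = begin
      card (λ g → ¬? (Sym? g))                    ≡⟨ ℕₚ.m+n∸m≡n s _ ⟨
      s + card (λ g → ¬? (Sym? g)) ∸ s            ≡⟨ cong (_∸ s) (begin-equality
        s + card (λ g → ¬? (Sym? g))
          ≡⟨ cong₂ _+_ (trans (sym Sym-size) (card-cong Sym? (λ g → ⊤? g ×-dec Sym? g) (λ _ σ → tt , σ) (λ _ → proj₂)))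
               (card-cong (λ g → ¬? (Sym? g)) (λ g → ⊤? g ×-dec ¬? (Sym? g)) (λ _ σ → tt , σ) (λ _ → proj₂)) ⟩
        card (λ g → ⊤? g ×-dec Sym? g) + card (λ g → ⊤? g ×-dec ¬? (Sym? g))
          ≡⟨ card-split (⊤? {h}) Sym? ⟨
        card (⊤? {h})
          ≡⟨ trans (card-⊤ {h}) order≡ ⟩
        s * s * s ∎) ⟩
      s * s * s ∸ s                               ≡⟨ arithmetic ⟩
      suc s * (s * s ∸ s)                         ≡⟨ cong (_* (s * s ∸ s)) (common-neighbours a) ⟨
      card P? * (s * s ∸ s)                       ≤⟨ double-count P? Q? (λ r g → g · r ≟ r) (s * s ∸ s) 1 rows
                                                       (λ g (g∉ , _) → card-unique (λ r → P? r ×-dec (g · r ≟ r))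
                                                         (λ r r′ ((x∼r , y∼r) , e) ((x∼r′ , y∼r′) , e′) → decidable-stable (r ≟ r′) λ r≢r′ →
                                                           g∉ (fixes-two⇒symmetry x∼r x∼r′ (common-neighbours-≁ a x∼r y∼r x∼r′ y∼r′ r≢r′) e e′))) ⟩
      card Q? * 1                                 ≡⟨ ℕₚ.*-identityʳ _ ⟩
      card Q?                                     ∎
      where
      open ≤-Reasoning
      arithmetic : s * s * s ∸ s ≡ suc s * (s * s ∸ s)
      arithmetic = sym (begin-equality
        suc s * (s * s ∸ s)                        ≡⟨ ℕₚ.*-distribˡ-∸ (suc s) (s * s) s ⟩
        suc s * (s * s) ∸ suc s * s                ≡⟨ cong₂ _∸_ (+-*-Solver.solve 1 (λ s → (con 1 :+ s) :* (s :* s) := s :* s :+ s :* s :* s) refl s)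
                                                        (ℕₚ.+-comm s (s * s)) ⟩
        s * s + s * s * s ∸ (s * s + s)            ≡⟨ ℕₚ.[m+n]∸[m+o]≡n∸o (s * s) (s * s * s) s ⟩
        s * s * s ∸ s                              ∎)
        where open +-*-Solver using (_:*_; _:=_; _:+_; con)

  -- A conjugate of a symmetry again fixes x^⊥ pointwise. That it belongs to the given group is the
  -- content of `fixes-two⇒symmetry`, for which `y` provides two noncollinear points.
  symmetriesⁿ : ∀ {y} → Aff y → NormalSubgroup
  symmetriesⁿ {y} a = record { subgroup = symmetryGroup ; conj∈ = conj∈ }
    where
    conj∈ : ∀ g {σ} → Sym σ → Sym (g ∙ σ ∙ g ⁻¹)
    conj∈ g {σ} σ∈ =
      let N? = λ r → (x ∼? r) ×-dec (y ∼? r)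
          r , x∼r , y∼r = card-positive⇒∃ N? (subst (1 ≤_) (sym (common-neighbours a)) (s≤s z≤n))
          r′ , (x∼r′ , y∼r′) , r′≢r = another N? (subst (2 ≤_) (sym (common-neighbours a)) (ℕₚ.m≤n⇒m≤1+n 2≤s)) r
      in fixes-two⇒symmetry x∼r x∼r′ (common-neighbours-≁ a x∼r y∼r x∼r′ y∼r′ (r′≢r ∘ sym)) (fixed r x∼r) (fixed r′ x∼r′)
      where
      fixed : ∀ p → x ∼ p → (g ∙ σ ∙ g ⁻¹) · p ≡ p
      fixed p x∼p = begin
        (g ∙ σ ∙ g ⁻¹) · p     ≡⟨ trans (mulPt act _ _ p) (mulPt act g σ _) ⟩
        g · σ · g ⁻¹ · p       ≡⟨ cong (g ·_) (symm σ σ∈ _ (∼x-act (g ⁻¹) x∼p)) ⟩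
        g · g ⁻¹ · p           ≡⟨ ·-inverseʳ g p ⟩
        p                      ∎
        where open ≡-Reasoning

  -- For an affine neighbour `y` of `q`, some common neighbour `p` of `x` and `y` is fixed. Outside
  -- `S` this `p` must be collinear with `r`, so it lies on `X`, and there the only neighbour of `y`
  -- is `q`.
  fixes-line : ∀ {g r X} → ¬ Sym g → x ∈ X → r ∈ X → r ≢ x → g · r ≡ r → ∀ {q} → q ∈ X → g · q ≡ q
  fixes-line {g} {r} {X} g∉ x∈X r∈X r≢x gr≡r {q} q∈X with q ≟ x
  ... | yes refl = fixes-x g
  ... | no q≢x =
    let y , a , y∼q = affine-neighbour q (X , x∈X , q∈X) q≢x
        p , x∼p , y∼p , gp≡p = fixes-some a g
        p∼r = decidable-stable (p ∼? r) (λ p≁r → g∉ (fixes-two⇒symmetry x∼p (X , x∈X , r∈X) p≁r gp≡p gr≡r))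
        p∈X = no-triangle x∈X r∈X (r≢x ∘ sym) (∼-sym x∼p) p∼r
    in subst (λ p → g · p ≡ p) (project-unique (aff∉ a x∈X) p∈X y∼p q∈X y∼q) gp≡p

  -- Elations that move a base point `y` along a line

  module BasePoint {y} (a : Aff y) where

    Sⁿ : NormalSubgroup
    Sⁿ = symmetriesⁿ a

    private module S/ = Quotient Sⁿ

    -- By transitivity an affine neighbour of `r` can be carried to one of another point `q` on the
    -- line joining `x` and `r`; this takes `r` to `q`.
    moves-another : ∀ {r} → x ∼ r → r ≢ x → ∃[ e ] (e · r ≢ r)
    moves-another {r} (X , x∈X , r∈X) r≢x =
      let q , (q∈X , q≢x) , q≢r = another (λ p → (p ∈? X) ×-dec ¬? (p ≟ x)) (subst (2 ≤_) (sym (other-points X x x∈X)) 2≤s) r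
          z , b , z∼r = affine-neighbour r (X , x∈X , r∈X) r≢x
          w , c , w∼q = affine-neighbour q (X , x∈X , q∈X) q≢x
          e , ez≡w = sharp b c
          w∼er = subst (_∼ e · r) ez≡w (∼-act e z∼r)
      in e , λ er≡r → q≢r (project-unique (aff∉ c x∈X) q∈X w∼q r∈X (subst (w ∼_) er≡r w∼er))

    -- g fixes a line through x pointwise and k another one, so both products agree on either line.
    commute-different : ∀ g k r → ¬ Sym g → x ∼ r → y ∼ r → g · r ≡ r → k · r ≢ r → S/.Commute g k
    commute-different g k r g∉ (X , x∈X , r∈X) y∼r gr≡r kr≢r =
      let r′ , (X′ , x∈X′ , r′∈X′) , y∼r′ , kr′≡r′ = fixes-some a k
          x∼r = X , x∈X , r∈X
          x∼r′ = X′ , x∈X′ , r′∈X′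
          k∉ = λ k∈ → kr≢r (symm k k∈ r x∼r)
          r≢x = aff-neighbour≢ a y∼r
          r′≢x = aff-neighbour≢ a y∼r′
          r≁r′ = common-neighbours-≁ a x∼r y∼r x∼r′ y∼r′ (λ r≡r′ → kr≢r (subst (λ r → k · r ≡ r) (sym r≡r′) kr′≡r′))
      in fixes-two⇒symmetry x∼r x∼r′ r≁r′
           (agree r (trans (cong (k ·_) gr≡r) (sym (fixes-line g∉ x∈X r∈X r≢x gr≡r (on-fixed-line k x∈X r∈X)))))
           (agree r′ (trans (fixes-line k∉ x∈X′ r′∈X′ r′≢x kr′≡r′ (on-fixed-line g x∈X′ r′∈X′)) (cong (g ·_) (sym kr′≡r′))))
      where
      agree : ∀ p → k · g · p ≡ g · k · p → ((g ∙ k) ⁻¹ ∙ (k ∙ g)) · p ≡ p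
      agree p e = trans (mulPt act _ _ p) (·-move (g ∙ k)
        (trans (mulPt act g k p) (trans (sym e) (sym (mulPt act k g p)))))

    -- When `g` and `k` fix the same point `r`, choose `e` moving `r`. Then `k ∙ e` and `e` both
    -- move `r`, so both commute with `g` modulo `S`, and so does their quotient `k`.
    abelian : ∀ g k → S/.Commute g k
    abelian g k with Sym? g
    ... | yes g∈ = S/.≈-trans (S/.∙-congʳ (S/.∈⇒≈ε g∈))
                     (S/.≈-trans (S/.≈-sym (S/.commutes-ε k)) (S/.∙-congˡ (S/.≈-sym (S/.∈⇒≈ε g∈))))
    ... | no g∉ with fixes-some a g
    ... | r , x∼r , y∼r , gr≡r with k · r ≟ r
    ... | no kr≢r  = commute-different g k r g∉ x∼r y∼r gr≡r kr≢r
    ... | yes kr≡r =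
      let e , er≢r = moves-another x∼r (aff-neighbour≢ a y∼r)
          ker≢r = λ ker≡r → er≢r (·-injective k (trans (trans (sym (mulPt act k e r)) ker≡r) (sym kr≡r)))
          C = S/.centralizer g
      in subst (C ∋_) (solve 2 (λ k e → k ⊕ e ⊕ ⊖ e ⊜ k) refl k e)
           (Subgroup.∙∈ C {k ∙ e} (commute-different g (k ∙ e) r g∉ x∼r y∼r gr≡r ker≢r)
             (Subgroup.⁻¹∈ C {e} (commute-different g e r g∉ x∼r y∼r gr≡r er≢r)))

    E : Pred (Fin h) 0ℓ
    E e = e · y ∼ y

    E? : Decidable E
    E? e = e · y ∼? y

    fixes-y⇒ε : ∀ {g} → g · y ≡ y → g ≡ ε
    fixes-y⇒ε e = sharp-unique a (trans e (sym (idPt act y)))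

    E-stabilizes : ∀ {e L} → y ∈ L → e · y ∈ L → e ∗ L ≡ L
    E-stabilizes = stabilizes _ a

    E-square : ∀ e → E e → E (e ∙ e)
    E-square e (L , ey∈L , y∈L) = L ,
      subst (_∈ L) (sym (mulPt act e e y)) (stab-act e (E-stabilizes y∈L ey∈L) ey∈L) , y∈L

    -- On another line through `y` the neighbour `r` of `x` is fixed, hence collinear with both `y`
    -- and `σ · y`. These lie on a line missing `r`, so they coincide.
    E∩S : ∀ {σ} → Sym σ → E σ → σ ≡ ε
    E∩S {σ} σ∈ (L , σy∈L , y∈L) =
      let M , y∈M , M≢L = another-line y L
          r , r∈M , x∼r = project x M (aff-line a y∈M)
          r∉L = λ r∈L → M≢L (partialLinear y r M L (aff≢ a x∼r) y∈M r∈M y∈L r∈L)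
          r∼σy = subst (_∼ σ · y) (symm σ σ∈ r x∼r) (∼-act σ (M , r∈M , y∈M))
      in fixes-y⇒ε (project-unique r∉L σy∈L r∼σy y∈L (M , r∈M , y∈M))

    E-fixes : ∀ e → E e → ∃[ L ] (y ∈ L × e ∗ L ≡ L × ∃[ r ] (r ∈ L × x ∼ r × e · r ≡ r))
    E-fixes e (L , ey∈L , y∈L) =
      let eL≡L = E-stabilizes y∈L ey∈L
          r , r∈L , x∼r = project x L (aff-line a y∈L)
      in L , y∈L , eL≡L , r , r∈L , x∼r ,
         project-unique (aff-line a y∈L) (stab-act e eL≡L r∈L) (∼x-act e x∼r) r∈L x∼r

    -- Both `e` and `f` fix a common neighbour of `x` and `y`. If it is the same one, they stabilize
    -- the same line and `E∩S` kills `e ⁻¹ ∙ f`. If not, `f` fixes both points since it differs from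
    -- `e` by a symmetry, so `f` and then `e` lie in `E ∩ S`.
    E-unique : ∀ e f → E e → E f → Sym (e ⁻¹ ∙ f) → e ≡ f
    E-unique e f Ee Ef σ∈ with E-fixes e Ee | E-fixes f Ef
    ... | L , y∈L , eL , r , r∈L , x∼r , er≡r | M , y∈M , fM , r′ , r′∈M , x∼r′ , fr′≡r′ with r ≟ r′
    ... | yes refl = sym (trans (f≡ (e ⁻¹ ∙ f) refl) (trans (cong (e ∙_) σ≡ε) (identityʳ e)))
      where
      f≡ : ∀ σ → e ⁻¹ ∙ f ≡ σ → f ≡ e ∙ σ
      f≡ _ refl = solve 2 (λ e f → f ⊜ e ⊕ (⊖ e ⊕ f)) refl e f
      L≡M : L ≡ M
      L≡M = partialLinear y r L M (aff≢ a x∼r) y∈L r∈L y∈M r′∈M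
      σ≡ε : e ⁻¹ ∙ f ≡ ε
      σ≡ε = E∩S σ∈ (L , stab-act _ (Subgroup.∙∈ (stabilizer L) {e ⁻¹} {f}
              (Subgroup.⁻¹∈ (stabilizer L) {e} eL) (subst (λ L → f ∗ L ≡ L) (sym L≡M) fM)) y∈L , y∈L)
    ... | no r≢r′ = trans e≡ε (sym f≡ε)
      where
      fr≡r : f · r ≡ r
      fr≡r = begin
        f · r                   ≡⟨ cong (_· r) (solve 2 (λ e f → f ⊜ e ⊕ (⊖ e ⊕ f)) refl e f) ⟩
        (e ∙ (e ⁻¹ ∙ f)) · r    ≡⟨ mulPt act e _ r ⟩
        e · (e ⁻¹ ∙ f) · r      ≡⟨ cong (e ·_) (symm _ σ∈ r x∼r) ⟩
        e · r                   ≡⟨ er≡r ⟩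
        r                       ∎
        where open ≡-Reasoning
      f∈ : Sym f
      f∈ = fixes-two⇒symmetry x∼r x∼r′ (common-neighbours-≁ a x∼r (L , y∈L , r∈L) x∼r′ (M , y∈M , r′∈M) r≢r′) fr≡r fr′≡r′
      f≡ε : f ≡ ε
      f≡ε = E∩S f∈ Ef
      e≡ε : e ≡ ε
      e≡ε = E∩S (subst Sym (solve 2 (λ e f → f ⊕ ⊖ (⊖ e ⊕ f) ⊜ e) refl e f)
        (Subgroup.∙∈ symmetryGroup f∈ (Subgroup.⁻¹∈ symmetryGroup σ∈))) Ee

    -- For collinear y and g y these are the affine points of the joining line; otherwise exactly one of
    -- the 1 + s common neighbours of y and g y lies in x^⊥.
    affine-common-neighbours : ∀ g → ¬ Sym g → card (λ z → Aff? z ×-dec ((z ∼? y) ×-dec (z ∼? (g · y)))) ≡ s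
    affine-common-neighbours g g∉ with g · y ∼? y
    ... | yes (L , gy∈L , y∈L) = trans
      (card-cong (λ z → Aff? z ×-dec ((z ∼? y) ×-dec (z ∼? (g · y)))) (λ z → (z ∈? L) ×-dec Aff? z)
        (λ z (b , z∼y , z∼gy) → no-triangle y∈L gy∈L y≢gy z∼y z∼gy , b)
        (λ z (z∈L , b) → b , (L , z∈L , y∈L) , (L , z∈L , gy∈L)))
      (affine-points L (aff-line a y∈L))
      where
      y≢gy : y ≢ g · y
      y≢gy e = g∉ (subst Sym (sym (fixes-y⇒ε (sym e))) (Subgroup.ε∈ symmetryGroup))
    ... | no gy≁y with fixes-some a g
    ... | r₀ , x∼r₀ , (L₀ , y∈L₀ , r₀∈L₀) , gr₀≡r₀ = trans
      (correspondence (λ z → Aff? z ×-dec ((z ∼? y) ×-dec (z ∼? (g · y)))) (λ L → (y ∈? L) ×-dec ¬? (L ≟ L₀)) _∈?_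
        (λ z (b , (L , z∈L , y∈L) , z∼gy) → L , (y∈L , λ { refl → b (subst (x ∼_) (r₀-only z∈L z∼gy) x∼r₀) }) , z∈L)
        (λ z L M (b , _ , z∼gy) (y∈L , _) (y∈M , _) z∈L z∈M →
          partialLinear y z L M (λ { refl → gy≁y (∼-sym z∼gy) }) y∈L z∈L y∈M z∈M)
        (λ L (y∈L , L≢L₀) → let z , z∈L , gy∼z = project (g · y) L (gy∉ y∈L) in
          z , (affine y∈L L≢L₀ z∈L gy∼z , (L , z∈L , y∈L) , ∼-sym gy∼z) , z∈L)
        (λ L z w (y∈L , _) (_ , _ , z∼gy) (_ , _ , w∼gy) z∈L w∈L →
          project-unique (gy∉ y∈L) z∈L (∼-sym z∼gy) w∈L (∼-sym w∼gy)))
      (other-lines y L₀ y∈L₀)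
      where
      gy∉ : ∀ {L} → y ∈ L → ¬ g · y ∈ L
      gy∉ y∈L gy∈L = gy≁y (_ , gy∈L , y∈L)
      gy∼r₀ : g · y ∼ r₀
      gy∼r₀ = subst (g · y ∼_) gr₀≡r₀ (∼-act g (L₀ , y∈L₀ , r₀∈L₀))
      r₀-only : ∀ {z} → z ∈ L₀ → z ∼ g · y → r₀ ≡ z
      r₀-only z∈L₀ z∼gy = project-unique (gy∉ y∈L₀) r₀∈L₀ gy∼r₀ z∈L₀ (∼-sym z∼gy)
      affine : ∀ {L z} → y ∈ L → L ≢ L₀ → z ∈ L → g · y ∼ z → Aff z
      affine {L} {z} y∈L L≢L₀ z∈L gy∼z x∼z = g∉ (fixes-two⇒symmetry x∼z x∼r₀
        (common-neighbours-≁ a x∼z (L , y∈L , z∈L) x∼r₀ (L₀ , y∈L₀ , r₀∈L₀)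
          (λ { refl → L≢L₀ (partialLinear y z L L₀ (aff≢ a x∼z) y∈L z∈L y∈L₀ r₀∈L₀) }))
        (fixes-neighbour g a x∼z (L , y∈L , z∈L) gy∼z) gr₀≡r₀)

    -- A factorization is determined by the point `e · y`, and applying `e` turns the condition on
    -- the second factor into collinearity of `g · y` with `e · y`.
    E-products : ∀ g → ¬ Sym g → card (λ e → E? e ×-dec E? (e ⁻¹ ∙ g)) ≡ s
    E-products g g∉ = trans
      (correspondence (λ e → E? e ×-dec E? (e ⁻¹ ∙ g)) (λ z → Aff? z ×-dec ((z ∼? y) ×-dec (z ∼? (g · y)))) (λ e z → e · y ≟ z)
        (λ e (Ee , Ee⁻¹g) → e · y , (aff-act e a , Ee ,
          ∼-sym (subst (_∼ e · y) (trans (cong (e ·_) (mulPt act (e ⁻¹) g y)) (·-inverseʳ e (g · y))) (∼-act e Ee⁻¹g))) , refl)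
        (λ _ _ _ _ _ _ e f → trans (sym e) f)
        (λ z (b , z∼y , z∼gy) → let e , ey≡z = sharp a b in
          e , (subst (_∼ y) (sym ey≡z) z∼y ,
               subst₂ _∼_ (sym (mulPt act (e ⁻¹) g y)) (·-move e ey≡z) (∼-act (e ⁻¹) (∼-sym z∼gy))) , ey≡z)
        (λ _ _ _ _ _ _ e f → sharp-unique a (trans e (sym f))))
      (affine-common-neighbours g g∉)

    -- σ ↦ σ L is injective from the s symmetries to the s affine lines on q.
    line-orbit : ∀ {L q X M} → y ∈ L → q ∈ L → x ∈ X → q ∈ X → q ∈ M → M ≢ X → ∃[ σ ] (Sym σ × σ ∗ L ≡ M)
    line-orbit {L} {q} {X} {M} y∈L q∈L x∈X q∈X q∈M M≢X =
      proj₂ (⊆∧card-≥⇒⊇ (λ M → (q ∈? M) ×-dec ¬? (M ≟ X)) Q? (λ _ → proj₁) (begin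
        card (λ M → (q ∈? M) ×-dec ¬? (M ≟ X))  ≡⟨ other-lines q X q∈X ⟩
        s                                       ≡⟨ Sym-size ⟨
        card Sym?                               ≤⟨ card-inj Sym? Q? (_∗ L) (λ σ σ∈ → (on-q σ σ∈ , not-X σ) , σ , σ∈ , refl) injective ⟩
        card Q?                                 ∎) M (q∈M , M≢X))
      where
      open ≤-Reasoning
      Q? = λ M → ((q ∈? M) ×-dec ¬? (M ≟ X)) ×-dec any? (λ σ → Sym? σ ×-dec (σ ∗ L ≟ M))
      on-q : ∀ σ → Sym σ → q ∈ σ ∗ L
      on-q σ σ∈ = subst (_∈ σ ∗ L) (symm σ σ∈ q (X , x∈X , q∈X)) (∈-act σ q∈L)
      not-X : ∀ σ → σ ∗ L ≢ X
      not-X σ e = aff-line a y∈L (∈-act⁻ σ (subst₂ _∈_ (sym (fixes-x σ)) (sym e) x∈X))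
      injective : ∀ σ τ → Sym σ → Sym τ → σ ∗ L ≡ τ ∗ L → σ ≡ τ
      injective σ τ σ∈ τ∈ e = ∙-cancelˡ (σ ⁻¹) σ τ (trans (inverseˡ σ) (sym (E∩S
        (Subgroup.∙∈ symmetryGroup (Subgroup.⁻¹∈ symmetryGroup σ∈) τ∈)
        (L , stab-act _ (trans (mulLn act _ _ L) (trans (cong (σ ⁻¹ ∗_) (sym e)) (∗-inverseˡ σ L))) y∈L , y∈L))))

-- From central symmetries to root-elations

mainTheorem11 : ∀ {np nl h s : ℕ} (𝒮 : Incidence np nl) (x : Fin np)
    (G : FinGroup h) (act : AutAction 𝒮 G) →
    IsGQ 𝒮 s s → Thick s s → s % 2 ≡ 1 →
    IsEGQ 𝒮 G act x → HasSymmetryGroup act x s →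
    (∀ L → ¬ I 𝒮 x L → ElementaryAbelianStab act L) →
    ∀ L → ¬ I 𝒮 x L → ∀ q → I 𝒮 q L → Collinear 𝒮 x q →
    card (Central? G) ≤ card (RootElt? act L q)
mainTheorem11 {s = s} 𝒮 x G act gq (2≤s , _) s%2≡1 egq symmetries elementary L x∉L q q∈L x∼q@(X , x∈X , q∈X) =
  let open ≤-Reasoning in begin
    card (Central? G)        ≤⟨ card-mono (Central? G) Sym? centre⊆S ⟩
    card Sym?                ≡⟨ trans Sym-size (sym (stabilizer-size L x∉L)) ⟩
    card (λ g → g ∗ L ≟ L)   ≤⟨ card-mono (λ g → g ∗ L ≟ L) (RootElt? act L q) root ⟩
    card (RootElt? act L q)  ∎
  where
  open FiniteGroup G
  open Quadrangle 𝒮 gq 2≤s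
  open Affine x
  open Elation 𝒮 x G act gq 2≤s egq symmetries
  open HasSymmetryGroup symmetries using () renaming (S to Sym; S? to Sym?; size to Sym-size)

  base : ∃[ y ] (y ∈ L × y ≢ q)
  base = another-point L q

  y∈L : proj₁ base ∈ L
  y∈L = proj₁ (proj₂ base)

  y-affine : Aff (proj₁ base)
  y-affine = affine-on x∉L q∈L x∼q y∈L (proj₂ (proj₂ base))

  open BasePoint y-affine

  s-odd : ¬ 2 ∣ s
  s-odd 2∣s = contradiction (trans (sym s%2≡1) (n∣m⇒m%n≡0 s 2 2∣s)) λ ()

  h-odd : ¬ 2 ∣ _
  h-odd = subst (λ h → ¬ 2 ∣ h) (sym order≡) (odd-product (odd-product s-odd s-odd) s-odd)

  camina : ∀ g σ → ¬ Sym g → Sym σ → ∃[ k ] (k ∙ g ∙ k ⁻¹ ≡ g ∙ σ)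
  camina = Transversal.coset-conjugate G Sⁿ E? s-odd h-odd abelian E-unique E-square E-products

  S-central : ∀ σ → Sym σ → ∀ g → σ ∙ g ≡ g ∙ σ
  S-central = let _ , p , p-prime , exponent = elementary L x∉L in
    CaminaPair.Centrality.central G Sⁿ (stabilizer L) 2≤s order≡ Sym-size (stabilizer-size L x∉L) abelian camina
      (λ a aL a∈ → E∩S a∈ (L , stab-act a aL y∈L , y∈L)) p-prime exponent

  -- A central element is its whole conjugacy class, whereas outside `S` the class contains a coset
  -- of `S`, which has `s ≥ 2` elements.
  centre⊆S : ∀ z → Central G z → Sym z
  centre⊆S z z-central with Sym? z
  ... | yes z∈ = z∈
  ... | no z∉ =
    let σ , σ∈ , σ≢ε = another Sym? (subst (2 ≤_) (sym Sym-size) 2≤s) ε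
        k , e = camina z σ z∉ σ∈
    in contradiction (∙-cancelˡ z σ ε (trans (sym e) (trans (cong (_∙ k ⁻¹) (sym (z-central k)))
         (solve 2 (λ z k → z ⊕ k ⊕ ⊖ k ⊜ z ⊕ :ε) refl z k)))) σ≢ε

  root : ∀ g → g ∗ L ≡ L → RootElt act L q g
  root g gL = gL , fixes
    where
    fixes : ∀ M → q ∈ M → g ∗ M ≡ M
    fixes M q∈M with M ≟ X
    ... | yes refl = IsEGQ.fixesLinesThroughX egq g X x∈X
    ... | no M≢X with line-orbit y∈L q∈L x∈X q∈X q∈M M≢X
    ... | σ , σ∈ , refl = begin
      g ∗ σ ∗ L      ≡⟨ mulLn act g σ L ⟨
      (g ∙ σ) ∗ L    ≡⟨ cong (_∗ L) (S-central σ σ∈ g) ⟨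
      (σ ∙ g) ∗ L    ≡⟨ mulLn act σ g L ⟩
      σ ∗ g ∗ L      ≡⟨ cong (σ ∗_) gL ⟩
      σ ∗ L          ∎
      where open ≡-Reasoning
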